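{- The following formal power series identities in $q$ hold: $$\sum_{i,j\ge 0}\frac{q^{2i^2+6ij+6j^2}}{(q;q)_i\,(q^3;q^3)_j}=\frac{1}{(q^2,q^3,q^9,q^{10};q^{12})_\infty},$$ $$\sum_{i,j,k,l\ge 0}\frac{q^{\frac{3(i+j+k+2l)(i+j+k+2l-1)}{2}+3i+5j+\frac{3j(j-1)}{2}+k+\frac{3k(k-1)}{2}+3l}}{(q^3;q^3)_i\,(q^3;q^3)_j\,(q^3;q^3)_k\,(q^6;q^6)_l}=\sum_{i,j\ge 0}\frac{q^{2i^2+6ij+6j^2+i}}{(q;q)_i\,(q^3;q^3)_j}+\sum_{i,j\ge 0}\frac{q^{2i^2+6ij+6j^2+4i+6j+1}}{(q;q)_i\,(q^3;q^3)_j}=(-q,-q^3,-q^5,-q^6;q^6)_\infty.$$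
   Context: For $n\ge 0$, $(a;q)_n=\prod_{0\le t<n}(1-aq^t)$, $(a;q)_\infty=\prod_{t\ge 0}(1-aq^t)$, and $(a_1,\dots,a_r;q)_m=(a_1;q)_m\cdots(a_r;q)_m$ for $m$ a nonnegative integer or $\infty$. All identities are identities of formal power series. -}

module Defs where

open import Data.Bool using (if_then_else_)
open import Data.Empty using (⊥-elim)
open import Data.Integer as ℤ using (ℤ; 0ℤ; 1ℤ)
import Data.Integer.Properties as ℤₚ
open import Data.List using (List; []; _∷_; foldr; map; upTo; applyUpTo; cartesianProduct)
open import Data.List.Membership.Propositional using (_∈_; _∉_)
open import Data.List.Membership.Propositional.Properties using (∈-upTo⁺; ∈-cartesianProduct⁺)
open import Data.List.Relation.Unary.Unique.Propositional using (Unique)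
open import Data.List.Relation.Unary.Unique.Propositional.Properties using (upTo⁺; cartesianProduct⁺)
open import Data.Nat using (ℕ; zero; suc; _+_; _*_; _∸_; _^_; _≤_; _<_; z≤n; s≤s; _≟_; _≤?_)
open import Data.Nat.DivMod using (_/_)
open import Data.Nat.Properties
open import Data.Product using (Σ; _×_; _,_; proj₁)
open import Relation.Binary.PropositionalEquality
open import Relation.Nullary using (does; yes; no)
open import Relation.Nullary.Decidable using (dec-false)

-- Formal power series in q over ℤ, as coefficient sequences; two series are
-- equal when they are pointwise equal (_≗_).
PS : Set
PS = ℕ → ℤ

sumℤ : List ℤ → ℤ
sumℤ = foldr ℤ._+_ 0ℤ

infix  9 q^_
infix  8 ⊝_
infixl 7 _⊛_ _⊘_
infixl 6 _⊕_ _⊖_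

q^_ : ℕ → PS
(q^ e) n = if does (n ≟ e) then 1ℤ else 0ℤ

1ₛ : PS
1ₛ = q^ 0

_⊕_ _⊖_ _⊛_ _⊘_ : PS → PS → PS

(f ⊕ g) n = f n ℤ.+ g n

⊝_ : PS → PS
(⊝ f) n = ℤ.- f n

f ⊖ g = f ⊕ ⊝ g

(f ⊛ g) n = sumℤ (applyUpTo (λ k → f k ℤ.* g (n ∸ k)) (suc n))

-- Long division.  It is the quotient only when the divisor has constant term 1
-- (see ⊘-⊛); q-Pochhammer divisors satisfy this (see poch-unit, pochs∞-unit).
(h ⊘ f) zero    = h 0
(h ⊘ f) (suc n) = ((λ m → h (suc m) ℤ.- h 0 ℤ.* f (suc m)) ⊘ f) n

pow : PS → ℕ → PS
pow f zero    = 1ₛ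
pow f (suc t) = f ⊛ pow f t

infix 9 ⟨_⨾_⟩_ ⟨_⨾_⟩∞

⟨_⨾_⟩_ : PS → PS → ℕ → PS
⟨ a ⨾ Q ⟩ zero  = 1ₛ
⟨ a ⨾ Q ⟩ suc m = (1ₛ ⊖ a ⊛ pow Q m) ⊛ ⟨ a ⨾ Q ⟩ m

-- The q-adic limit of the finite products when Q has constant term 0: the
-- coefficient of qⁿ no longer changes after n + 1 factors (see poch-stable).
poch∞ : PS → PS → PS
poch∞ a Q n = (⟨ a ⨾ Q ⟩ suc n) n

⟨_⨾_⟩∞ : List PS → PS → PS
⟨ as ⨾ Q ⟩∞ = foldr (λ a p → poch∞ a Q ⊛ p) 1ₛ as

-- Each power of q receives contributions from only finitely many indices.
Summable : {I : Set} → (I → PS) → Set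
Summable {I} F = ∀ n → Σ (List I) λ L → Unique L × (∀ v → v ∉ L → F v n ≡ 0ℤ)

∑ : {I : Set} (F : I → PS) → Summable F → PS
∑ F s n = sumℤ (map (λ v → F v n) (proj₁ (s n)))

sum-zero : ∀ n {f : ℕ → ℤ} → (∀ k → k < n → f k ≡ 0ℤ) → sumℤ (applyUpTo f n) ≡ 0ℤ
sum-zero zero    h = refl
sum-zero (suc n) h = cong₂ ℤ._+_ (h 0 (s≤s z≤n)) (sum-zero n (λ k k<n → h (suc k) (s≤s k<n)))

⊘-⊛ : ∀ h f → f 0 ≡ 1ℤ → (h ⊘ f) ⊛ f ≗ h
⊘-⊛ h f f0 zero = begin
  h 0 ℤ.* f 0 ℤ.+ 0ℤ  ≡⟨ ℤₚ.+-identityʳ _ ⟩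
  h 0 ℤ.* f 0         ≡⟨ cong (h 0 ℤ.*_) f0 ⟩
  h 0 ℤ.* 1ℤ          ≡⟨ ℤₚ.*-identityʳ _ ⟩
  h 0                 ∎
  where open ≡-Reasoning
⊘-⊛ h f f0 (suc n) = begin
  x ℤ.+ (h′ ⊘ f ⊛ f) n          ≡⟨ cong (λ z → x ℤ.+ z) (⊘-⊛ h′ f f0 n) ⟩
  x ℤ.+ (h (suc n) ℤ.- x)       ≡⟨ ℤₚ.+-comm x _ ⟩
  (h (suc n) ℤ.- x) ℤ.+ x       ≡⟨ ℤₚ.+-assoc (h (suc n)) (ℤ.- x) x ⟩
  h (suc n) ℤ.+ (ℤ.- x ℤ.+ x)   ≡⟨ cong (λ z → h (suc n) ℤ.+ z) (ℤₚ.+-inverseˡ x) ⟩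
  h (suc n) ℤ.+ 0ℤ              ≡⟨ ℤₚ.+-identityʳ _ ⟩
  h (suc n)                     ∎
  where
  open ≡-Reasoning
  x : ℤ
  x = h 0 ℤ.* f (suc n)
  h′ : PS
  h′ m = h (suc m) ℤ.- h 0 ℤ.* f (suc m)

⊛-unit : ∀ f g → f 0 ≡ 1ℤ → g 0 ≡ 1ℤ → (f ⊛ g) 0 ≡ 1ℤ
⊛-unit f g f0 g0 rewrite f0 | g0 = refl

⊛-zeroˡ : ∀ f g → f 0 ≡ 0ℤ → (f ⊛ g) 0 ≡ 0ℤ
⊛-zeroˡ f g f0 rewrite f0 = refl

factor-unit : ∀ a Q m → a 0 ≡ 0ℤ → (1ₛ ⊖ a ⊛ pow Q m) 0 ≡ 1ℤ
factor-unit a Q m a0 rewrite ⊛-zeroˡ a (pow Q m) a0 = refl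

poch-unit : ∀ a Q m → a 0 ≡ 0ℤ → (⟨ a ⨾ Q ⟩ m) 0 ≡ 1ℤ
poch-unit a Q zero    a0 = refl
poch-unit a Q (suc m) a0 =
  ⊛-unit (1ₛ ⊖ a ⊛ pow Q m) (⟨ a ⨾ Q ⟩ m) (factor-unit a Q m a0) (poch-unit a Q m a0)

pochs∞-unit : ∀ as Q → (∀ a → a ∈ as → a 0 ≡ 0ℤ) → ⟨ as ⨾ Q ⟩∞ 0 ≡ 1ℤ
pochs∞-unit []       Q h = refl
pochs∞-unit (a ∷ as) Q h =
  ⊛-unit (poch∞ a Q) (⟨ as ⨾ Q ⟩∞) (poch-unit a Q 1 (h a (here refl)))
         (pochs∞-unit as Q (λ b b∈as → h b (there b∈as)))
  where open import Data.List.Relation.Unary.Any using (here; there)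

pow-order : ∀ Q → Q 0 ≡ 0ℤ → ∀ t m → m < t → pow Q t m ≡ 0ℤ
pow-order Q Q0 (suc t) m (s≤s m≤t) = sum-zero (suc m) term
  where
  term : ∀ k → k < suc m → Q k ℤ.* pow Q t (m ∸ k) ≡ 0ℤ
  term zero    _         rewrite Q0 = refl
  term (suc k) (s≤s k<m)
    rewrite pow-order Q Q0 t (m ∸ suc k)
              (<-≤-trans (∸-monoʳ-< {m} {suc k} {0} (s≤s z≤n) k<m) m≤t)
    = ℤₚ.*-zeroʳ (Q (suc k))

factor-tail : ∀ a Q → Q 0 ≡ 0ℤ → ∀ t m → m < t → (1ₛ ⊖ a ⊛ pow Q t) m ≡ 1ₛ m
factor-tail a Q Q0 t m m<t
  rewrite sum-zero (suc m) {λ k → a k ℤ.* pow Q t (m ∸ k)}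
            (λ k _ → trans (cong (a k ℤ.*_) (pow-order Q Q0 t (m ∸ k) (≤-<-trans (m∸n≤m m k) m<t)))
                           (ℤₚ.*-zeroʳ (a k)))
  = ℤₚ.+-identityʳ (1ₛ m)

poch-step : ∀ a Q → Q 0 ≡ 0ℤ → ∀ n m → n < m → (⟨ a ⨾ Q ⟩ suc m) n ≡ (⟨ a ⨾ Q ⟩ m) n
poch-step a Q Q0 n m n<m = begin
  u 0 ℤ.* p n ℤ.+ sumℤ (applyUpTo (λ k → u (suc k) ℤ.* p (n ∸ suc k)) n)
    ≡⟨ cong₂ ℤ._+_ (cong (ℤ._* p n) (factor-tail a Q Q0 m 0 (≤-<-trans z≤n n<m)))
                   (sum-zero n (λ k k<n → cong (ℤ._* p (n ∸ suc k))
                      (factor-tail a Q Q0 m (suc k) (≤-<-trans k<n n<m)))) ⟩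
  1ℤ ℤ.* p n ℤ.+ 0ℤ  ≡⟨ ℤₚ.+-identityʳ _ ⟩
  1ℤ ℤ.* p n         ≡⟨ ℤₚ.*-identityˡ (p n) ⟩
  p n                ∎
  where
  open ≡-Reasoning
  u p : PS
  u = 1ₛ ⊖ a ⊛ pow Q m
  p = ⟨ a ⨾ Q ⟩ m

poch-stable : ∀ a Q → Q 0 ≡ 0ℤ → ∀ n m → n < m → (⟨ a ⨾ Q ⟩ m) n ≡ poch∞ a Q n
poch-stable a Q Q0 n (suc m) (s≤s n≤m) with n ≟ m
... | yes refl = refl
... | no  n≢m  = trans (poch-step a Q Q0 n m n<m) (poch-stable a Q Q0 n m n<m)
  where
  n<m : n < m
  n<m = ≤∧≢⇒< n≤m n≢m

⊘-order : ∀ h f n → (∀ m → m ≤ n → h m ≡ 0ℤ) → (h ⊘ f) n ≡ 0ℤ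
⊘-order h f zero    z = z 0 z≤n
⊘-order h f (suc n) z = ⊘-order _ f n λ m m≤n →
  trans (cong₂ (λ x y → x ℤ.- y ℤ.* f (suc m)) (z (suc m) (s≤s m≤n)) (z 0 z≤n)) refl

q^-order : ∀ e m → m < e → (q^ e) m ≡ 0ℤ
q^-order e m m<e = cong (if_then 1ℤ else 0ℤ) (dec-false (m ≟ e) (<⇒≢ m<e))

q^⊘-order : ∀ e d n → n < e → (q^ e ⊘ d) n ≡ 0ℤ
q^⊘-order e d n n<e = ⊘-order (q^ e) d n (λ m m≤n → q^-order e m (≤-<-trans m≤n n<e))

module _ {I : Set} (w : I → ℕ) (box : ℕ → List I) (box-unique : ∀ n → Unique (box n))
         (box-complete : ∀ n v → w v ≤ n → v ∈ box n) where

  summable : (e : I → ℕ) (d : I → PS) → (∀ v → w v ≤ e v) → Summable (λ v → q^ e v ⊘ d v)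
  summable e d w≤e n = box n , box-unique n , outside
    where
    outside : ∀ v → v ∉ box n → (q^ e v ⊘ d v) n ≡ 0ℤ
    outside v v∉ with w v ≤? n
    ... | yes w≤n = ⊥-elim (v∉ (box-complete n v w≤n))
    ... | no  w≰n = q^⊘-order (e v) (d v) n (<-≤-trans (≰⇒> w≰n) (w≤e v))

range : ℕ → List ℕ
range n = upTo (suc n)

range-unique : ∀ n → Unique (range n)
range-unique n = upTo⁺ (suc n)

summable₂ : (e : ℕ × ℕ → ℕ) (d : ℕ × ℕ → PS) → (∀ ((i , j) : ℕ × ℕ) → i + j ≤ e (i , j)) →
            Summable (λ v → q^ e v ⊘ d v)
summable₂ = summable (λ (i , j) → i + j) box unique complete
  where
  box : ℕ → List (ℕ × ℕ)
  box n = cartesianProduct (range n) (range n)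
  unique : ∀ n → Unique (box n)
  unique n = cartesianProduct⁺ (range-unique n) (range-unique n)
  complete : ∀ n ((i , j) : ℕ × ℕ) → i + j ≤ n → (i , j) ∈ box n
  complete n (i , j) le = ∈-cartesianProduct⁺ (∈-upTo⁺ (s≤s (m+n≤o⇒m≤o i le)))
                                              (∈-upTo⁺ (s≤s (m+n≤o⇒n≤o i le)))

summable₄ : (e : ℕ × ℕ × ℕ × ℕ → ℕ) (d : ℕ × ℕ × ℕ × ℕ → PS) →
            (∀ ((i , j , k , l) : ℕ × ℕ × ℕ × ℕ) → i + (j + (k + l)) ≤ e (i , j , k , l)) →
            Summable (λ v → q^ e v ⊘ d v)
summable₄ = summable (λ (i , j , k , l) → i + (j + (k + l))) box unique complete
  where
  box : ℕ → List (ℕ × ℕ × ℕ × ℕ)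
  box n = cartesianProduct (range n) (cartesianProduct (range n)
            (cartesianProduct (range n) (range n)))
  unique : ∀ n → Unique (box n)
  unique n = cartesianProduct⁺ (range-unique n) (cartesianProduct⁺ (range-unique n)
               (cartesianProduct⁺ (range-unique n) (range-unique n)))
  complete : ∀ n ((i , j , k , l) : ℕ × ℕ × ℕ × ℕ) → i + (j + (k + l)) ≤ n → (i , j , k , l) ∈ box n
  complete n (i , j , k , l) le =
    ∈-cartesianProduct⁺ (∈-upTo⁺ (s≤s (m+n≤o⇒m≤o i le)))
      (∈-cartesianProduct⁺ (∈-upTo⁺ (s≤s (m+n≤o⇒m≤o j le₁)))
        (∈-cartesianProduct⁺ (∈-upTo⁺ (s≤s (m+n≤o⇒m≤o k le₂)))
                             (∈-upTo⁺ (s≤s (m+n≤o⇒n≤o k le₂)))))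
    where
    le₁ : j + (k + l) ≤ n
    le₁ = m+n≤o⇒n≤o i le
    le₂ : k + l ≤ n
    le₂ = m+n≤o⇒n≤o j le₁

n≤c*n^2 : ∀ c n → n ≤ suc c * n ^ 2
n≤c*n^2 c zero    = z≤n
n≤c*n^2 c (suc n) = ≤-trans (m≤m*n (suc n) (suc n * 1)) (m≤n*m (suc n ^ 2) (suc c))

quad-bound : ∀ i j → i + j ≤ 2 * i ^ 2 + 6 * i * j + 6 * j ^ 2
quad-bound i j = +-mono-≤ (≤-trans (n≤c*n^2 1 i) (m≤m+n _ _)) (n≤c*n^2 5 j)

quadruple-bound : ∀ t i j u k v l →
  i + (j + (k + l)) ≤ t + 3 * i + 5 * j + u + k + v + 3 * l
quadruple-bound t i j u k v l = begin
  i + (j + (k + l))                          ≡⟨ +-assoc i j (k + l) ⟨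
  i + j + (k + l)                            ≡⟨ +-assoc (i + j) k l ⟨
  i + j + k + l                              ≤⟨ +-mono-≤ ijk (m≤n*m l 3) ⟩
  t + 3 * i + 5 * j + u + k + v + 3 * l      ∎
  where
  open ≤-Reasoning
  ij : i + j ≤ t + 3 * i + 5 * j
  ij = +-mono-≤ (≤-trans (m≤n*m i 3) (m≤n+m (3 * i) t)) (m≤n*m j 5)
  ijk : i + j + k ≤ t + 3 * i + 5 * j + u + k + v
  ijk = ≤-trans (+-monoˡ-≤ k (≤-trans ij (m≤m+n _ u))) (m≤m+n _ v)

summable-I : Summable (λ ((i , j) : ℕ × ℕ) →
  q^ (2 * i ^ 2 + 6 * i * j + 6 * j ^ 2)
    ⊘ (⟨ q^ 1 ⨾ q^ 1 ⟩ i ⊛ ⟨ q^ 3 ⨾ q^ 3 ⟩ j))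
summable-I = summable₂ _ _ λ (i , j) → quad-bound i j

summable-A : Summable (λ ((i , j) : ℕ × ℕ) →
  q^ (2 * i ^ 2 + 6 * i * j + 6 * j ^ 2 + i)
    ⊘ (⟨ q^ 1 ⨾ q^ 1 ⟩ i ⊛ ⟨ q^ 3 ⨾ q^ 3 ⟩ j))
summable-A = summable₂ _ _ λ (i , j) → ≤-trans (quad-bound i j) (m≤m+n _ _)

summable-B : Summable (λ ((i , j) : ℕ × ℕ) →
  q^ (2 * i ^ 2 + 6 * i * j + 6 * j ^ 2 + 4 * i + 6 * j + 1)
    ⊘ (⟨ q^ 1 ⨾ q^ 1 ⟩ i ⊛ ⟨ q^ 3 ⨾ q^ 3 ⟩ j))
summable-B = summable₂ _ _ λ (i , j) →
  ≤-trans (quad-bound i j) (≤-trans (m≤m+n _ (4 * i)) (≤-trans (m≤m+n _ (6 * j)) (m≤m+n _ 1)))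

-- In each n(n-1)/2 the truncated n ∸ 1 is harmless (at n = 0 the other factor
-- vanishes), and the floor division by 2 is exact.
summable-Q : Summable (λ ((i , j , k , l) : ℕ × ℕ × ℕ × ℕ) →
  q^ (3 * (i + j + k + 2 * l) * (i + j + k + 2 * l ∸ 1) / 2
       + 3 * i + 5 * j + 3 * j * (j ∸ 1) / 2 + k + 3 * k * (k ∸ 1) / 2 + 3 * l)
    ⊘ (⟨ q^ 3 ⨾ q^ 3 ⟩ i ⊛ ⟨ q^ 3 ⨾ q^ 3 ⟩ j ⊛ ⟨ q^ 3 ⨾ q^ 3 ⟩ k ⊛ ⟨ q^ 6 ⨾ q^ 6 ⟩ l))
summable-Q = summable₄ _ _ λ (i , j , k , l) →
  quadruple-bound (3 * (i + j + k + 2 * l) * (i + j + k + 2 * l ∸ 1) / 2) i j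
                  (3 * j * (j ∸ 1) / 2) k (3 * k * (k ∸ 1) / 2) l

{-# OPTIONS --safe #-}
-- Write p = q³ and w n = p^(n(n-1)/2).  All the sums have the form ∑ₙ w n c n, where c n is
-- the coefficient of tⁿ in
--   C(t) = (-a t, -b t; p)∞ / ((p t; p)∞ (p t²; p²)∞),   a b = p²,
-- with {a, b} = {q², q⁴} for the first identity and {q, q⁵} for the second.  For the quadruple
-- sum this is read off the summand; for the double sums the generating function
-- (-q² t; q)∞ / (p t²; p)∞, respectively (1 + q t)(-q³ t; q)∞ / (p t²; p)∞, satisfies the same
-- equation relating t to p t as C(t), and such an equation has a unique solution.
--
-- To evaluate ∑ₙ w n c n, split off r(t) = 1 / (p t; p)∞, so that C = r e.  Since
-- w (m + i) = w m · w i · p^(m i), the sum over the index of r is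
-- (-p^(m+1); p)∞ = (-p; p)∞ / (-p; p)ₘ by Euler, and w m · e m = (-p; p)ₘ · g m, where g m is the
-- coefficient of tᵐ in (-a t, -b t; p²)∞: both sides satisfy the same three-term recurrence.
-- Hence the sum is (-p; p)∞ ∑ₘ g m = (-p; p)∞ (-a, -b; p²)∞.
module Submission where

-- The equations in t agree for two reasons. From t to p t, the denominator (p t²; p)∞ of the double
-- sums loses (1 - p t²)(1 - p² t²), while that of C loses (1 - p t²)(1 - p t); multiplying by 1 + p
-- t completes 1 - p t to 1 - p² t² and puts 1 + p t beside (1 + a t)(1 + b t). The numerators of
-- the double sums are products in steps of q with p = q³, so they lose three consecutive factors.
-- From q² on these are a, p, b, as wanted; from q³ on they are p, q⁴, a, and the factor 1 + q t is
-- there to trade q⁴ = p q for b = q. The condition a b = p² gives the recurrence of e a coefficient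
-- p (1 + p^(m+1)), which contains the newest factor of (-p; p)ₘ₊₁; without it the recurrences of w
-- e and (-p; p) g would not match. Setting t = 1 and interchanging sums needs convergence, so the
-- argument runs in a commutative ring with a separated filtration. Cancelling 1 - u for u of
-- positive order replaces every division, and only at the end does the ring become that of integer
-- series in q.

open import Algebra.Bundles using (CommutativeRing)
import Algebra.Construct.Pointwise as Pointwise
import Algebra.Properties.CommutativeSemiring.Exp as CommutativeExp
import Algebra.Properties.Ring as RingProperties
import Algebra.Properties.Semiring.Exp as Exp
import Algebra.Properties.Semiring.Mult.TCOptimised as SemiringMult
import Algebra.Solver.Ring as RingSolver
open import Algebra.Solver.Ring.AlmostCommutativeRing using (_-Raw-AlmostCommutative⟶_; fromCommutativeRing)
open import Data.Bool using (if_then_else_)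
open import Data.Integer as ℤ using (ℤ; 0ℤ; 1ℤ)
import Data.Integer.Properties as ℤₚ
open import Data.List using (List; []; _∷_; _++_; applyUpTo; cartesianProduct; foldr; map)
import Data.List.Properties as Listₚ
open import Data.Maybe using (Maybe; just; nothing)
open import Data.Nat as ℕ using (ℕ; zero; suc; _∸_; _≤_; _<_; z≤n; s≤s)
import Data.Nat.Properties as ℕₚ
open import Data.Nat.DivMod using (_/_; m*n/n≡m)
open import Data.Nat.Solver using (module +-*-Solver)
open import Data.Product using (_,_)
import Data.Sign as Sign
open import Data.Sum using (inj₁; inj₂)
open import Function using (_∘_)
open import Level using (0ℓ)
open import Relation.Binary.PropositionalEquality as ≡ using (_≡_; _≗_)
import Relation.Binary.Reasoning.Setoid as SetoidReasoning
open import Relation.Nullary using (does; yes; no)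

-- A ring solver with integer coefficients, so that x - x cancels in an arbitrary
-- commutative ring.
module IntegerCoefficients (R : CommutativeRing 0ℓ 0ℓ) where
  open CommutativeRing R
  open import Data.Integer using (+_; -[1+_])
  open RingProperties ring using (-0#≈0#; -‿distribˡ-*; -‿distribʳ-*; -‿involutive; -‿+-comm)
  open SemiringMult semiring using (_×_; 1+×; ×-homo-+; ×1-homo-*)
  open SetoidReasoning setoid

  -- The optimised multiple makes `1 × 1#` reduce to `1#`, so `con 0ℤ` and `con 1ℤ` in solver
  -- equations evaluate to `0#` and `1#` themselves.
  embed : ℤ → Carrier
  embed (+ n)      = n × 1#
  embed (-[1+ n ]) = - (suc n × 1#)

  cancel-1 : ∀ x y → (1# + x) + - (1# + y) ≈ x + - y
  cancel-1 x y = begin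
    (1# + x) + - (1# + y)       ≈⟨ +-cong (+-comm 1# x) (sym (-‿+-comm 1# y)) ⟩
    (x + 1#) + (- 1# + - y)     ≈⟨ +-assoc x 1# _ ⟩
    x + (1# + (- 1# + - y))     ≈⟨ +-congˡ (+-assoc 1# (- 1#) (- y)) ⟨
    x + ((1# + - 1#) + - y)     ≈⟨ +-congˡ (+-congʳ (-‿inverseʳ 1#)) ⟩
    x + (0# + - y)              ≈⟨ +-congˡ (+-identityˡ _) ⟩
    x + - y                     ∎

  embed-⊖ : ∀ m n → embed (m ℤ.⊖ n) ≈ m × 1# + - (n × 1#)
  embed-⊖ m zero          = sym (trans (+-congˡ -0#≈0#) (+-identityʳ _))
  embed-⊖ zero (suc n)    = sym (+-identityˡ _)
  embed-⊖ (suc m) (suc n) = begin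
    embed (suc m ℤ.⊖ suc n)              ≡⟨ ≡.cong embed (ℤₚ.[1+m]⊖[1+n]≡m⊖n m n) ⟩
    embed (m ℤ.⊖ n)                      ≈⟨ embed-⊖ m n ⟩
    m × 1# + - (n × 1#)                  ≈⟨ cancel-1 _ _ ⟨
    (1# + m × 1#) + - (1# + n × 1#)      ≈⟨ +-cong (1+× m 1#) (-‿cong (1+× n 1#)) ⟨
    suc m × 1# + - (suc n × 1#)          ∎

  embed-neg : ∀ i → embed (ℤ.- i) ≈ - embed i
  embed-neg (+ zero)    = sym -0#≈0#
  embed-neg (+ suc n)   = refl
  embed-neg (-[1+ n ])  = sym (-‿involutive _)

  embed-+ : ∀ i j → embed (i ℤ.+ j) ≈ embed i + embed j
  embed-+ (+ m)      (+ n)      = ×-homo-+ 1# m n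
  embed-+ (+ m)      (-[1+ n ]) = embed-⊖ m (suc n)
  embed-+ (-[1+ m ]) (+ n)      = trans (embed-⊖ n (suc m)) (+-comm _ _)
  embed-+ (-[1+ m ]) (-[1+ n ]) = begin
    - (suc (suc (m ℕ.+ n)) × 1#)            ≡⟨ ≡.cong (λ k → - (k × 1#)) (≡.sym (ℕₚ.+-suc (suc m) n)) ⟩
    - ((suc m ℕ.+ suc n) × 1#)             ≈⟨ -‿cong (×-homo-+ 1# (suc m) (suc n)) ⟩
    - (suc m × 1# + suc n × 1#)          ≈⟨ -‿+-comm _ _ ⟨
    - (suc m × 1#) + - (suc n × 1#)      ∎

  embed-* : ∀ i j → embed (i ℤ.* j) ≈ embed i * embed j
  embed-* (+ m) (+ n) = begin
    embed (Sign.+ ℤ.◃ m ℕ.* n)             ≡⟨ ≡.cong embed (ℤₚ.+◃n≡+n (m ℕ.* n)) ⟩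
    (m ℕ.* n) × 1#                         ≈⟨ ×1-homo-* m n ⟩
    m × 1# * n × 1#                      ∎
  embed-* (+ m) (-[1+ n ]) = begin
    embed (Sign.- ℤ.◃ m ℕ.* suc n)         ≡⟨ ≡.cong embed (ℤₚ.-◃n≡-n (m ℕ.* suc n)) ⟩
    embed (ℤ.- (+ (m ℕ.* suc n)))          ≈⟨ embed-neg (+ (m ℕ.* suc n)) ⟩
    - ((m ℕ.* suc n) × 1#)                 ≈⟨ -‿cong (×1-homo-* m (suc n)) ⟩
    - (m × 1# * suc n × 1#)              ≈⟨ -‿distribʳ-* _ _ ⟩
    m × 1# * - (suc n × 1#)              ∎
  embed-* (-[1+ m ]) (+ n) = begin
    embed (Sign.- ℤ.◃ suc m ℕ.* n)         ≡⟨ ≡.cong embed (ℤₚ.-◃n≡-n (suc m ℕ.* n)) ⟩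
    embed (ℤ.- (+ (suc m ℕ.* n)))          ≈⟨ embed-neg (+ (suc m ℕ.* n)) ⟩
    - ((suc m ℕ.* n) × 1#)                 ≈⟨ -‿cong (×1-homo-* (suc m) n) ⟩
    - (suc m × 1# * n × 1#)              ≈⟨ -‿distribˡ-* _ _ ⟩
    - (suc m × 1#) * n × 1#              ∎
  embed-* (-[1+ m ]) (-[1+ n ]) = begin
    (suc m ℕ.* suc n) × 1#                 ≈⟨ ×1-homo-* (suc m) (suc n) ⟩
    suc m × 1# * suc n × 1#              ≈⟨ -‿involutive _ ⟨
    - - (suc m × 1# * suc n × 1#)        ≈⟨ -‿cong (-‿distribˡ-* _ _) ⟩
    - (- (suc m × 1#) * suc n × 1#)      ≈⟨ -‿distribʳ-* _ _ ⟩
    - (suc m × 1#) * - (suc n × 1#)      ∎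

  embedding : ℤ.+-*-rawRing -Raw-AlmostCommutative⟶ fromCommutativeRing R
  embedding = record
    { ⟦_⟧    = embed
    ; +-homo = embed-+
    ; *-homo = embed-*
    ; -‿homo = embed-neg
    ; 0-homo = refl
    ; 1-homo = refl
    }

  embed-≟ : ∀ i j → Maybe (embed i ≈ embed j)
  embed-≟ i j with i ℤ.≟ j
  ... | yes i≡j = just (reflexive (≡.cong embed i≡j))
  -- Distinct integers may still have equal images in `R`, so nothing can be concluded here.
  ... | no  _   = nothing

  open RingSolver ℤ.+-*-rawRing (fromCommutativeRing R) embedding embed-≟ public
    using (solve; con; _:+_; _:*_; _:-_; :-_; _:^_; _:=_)

-- Formal power series in t over a commutative ring.

module PowerSeries (R : CommutativeRing 0ℓ 0ℓ) where
  open CommutativeRing R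
  open Exp semiring using (_^_; ^-congˡ)
  open CommutativeExp commutativeSemiring using (^-distrib-*)
  open IntegerCoefficients R
  open SetoidReasoning setoid

  Series : Set
  Series = ℕ → Carrier

  infix  4 _≋_
  infixl 7 _⋆_

  _≋_ : Series → Series → Set
  f ≋ g = ∀ n → f n ≈ g n

  ∑< : ℕ → Series → Carrier
  ∑< n c = foldr _+_ 0# (applyUpTo c n)

  _⋆_ : Series → Series → Series
  (f ⋆ g) n = ∑< (suc n) (λ k → f k * g (n ∸ k))

  one : Series
  one n = if does (n ℕ.≟ 0) then 1# else 0#

  ∑<-cong-< : ∀ n {c d : Series} → (∀ k → k < n → c k ≈ d k) → ∑< n c ≈ ∑< n d
  ∑<-cong-< zero    h = refl
  ∑<-cong-< (suc n) h = +-cong (h 0 (s≤s z≤n)) (∑<-cong-< n λ k k<n → h (suc k) (s≤s k<n))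

  ∑<-cong : ∀ n {c d : Series} → c ≋ d → ∑< n c ≈ ∑< n d
  ∑<-cong n h = ∑<-cong-< n λ k _ → h k

  ∑<-zero : ∀ n {c : Series} → (∀ k → c k ≈ 0#) → ∑< n c ≈ 0#
  ∑<-zero zero    h = refl
  ∑<-zero (suc n) h = trans (+-cong (h 0) (∑<-zero n (h ∘ suc))) (+-identityˡ 0#)

  ∑<-+ : ∀ n (c d : Series) → ∑< n (λ k → c k + d k) ≈ ∑< n c + ∑< n d
  ∑<-+ zero    c d = sym (+-identityˡ 0#)
  ∑<-+ (suc n) c d = trans (+-congˡ (∑<-+ n (c ∘ suc) (d ∘ suc)))
    (solve 4 (λ w x y z → w :+ x :+ (y :+ z) := w :+ y :+ (x :+ z)) refl _ _ _ _)

  ∑<-* : ∀ n x (c : Series) → ∑< n (λ k → x * c k) ≈ x * ∑< n c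
  ∑<-* zero    x c = sym (zeroʳ x)
  ∑<-* (suc n) x c = trans (+-congˡ (∑<-* n x (c ∘ suc))) (sym (distribˡ x _ _))

  ⋆-cong : ∀ {f f′ g g′} → f ≋ f′ → g ≋ g′ → f ⋆ g ≋ f′ ⋆ g′
  ⋆-cong hf hg n = ∑<-cong (suc n) λ k → *-cong (hf k) (hg (n ∸ k))

  ⋆-congˡ-≤ : ∀ n {f g g′ : Series} → (∀ k → k ≤ n → g k ≈ g′ k) → (f ⋆ g) n ≈ (f ⋆ g′) n
  ⋆-congˡ-≤ n {f} h = ∑<-cong (suc n) λ k → *-congˡ {f k} (h (n ∸ k) (ℕₚ.m∸n≤m n k))

  ⋆-0 : ∀ f g → (f ⋆ g) 0 ≈ f 0 * g 0
  ⋆-0 f g = +-identityʳ _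

  ⋆-distribʳ : ∀ (h f g : Series) → (λ n → f n + g n) ⋆ h ≋ λ n → (f ⋆ h) n + (g ⋆ h) n
  ⋆-distribʳ h f g n = trans (∑<-cong (suc n) λ k → distribʳ (h (n ∸ k)) (f k) (g k))
    (∑<-+ (suc n) (λ k → f k * h (n ∸ k)) (λ k → g k * h (n ∸ k)))

  ⋆-scaleˡ : ∀ x (f g : Series) → (λ n → x * f n) ⋆ g ≋ λ n → x * (f ⋆ g) n
  ⋆-scaleˡ x f g n = trans (∑<-cong (suc n) λ k → *-assoc x (f k) (g (n ∸ k)))
    (∑<-* (suc n) x (λ k → f k * g (n ∸ k)))

  -- The definition unfolds to the recursion (f ⋆ g) (suc n) = f 0 * g (suc n) + (f ∘ suc ⋆ g) n;
  -- this is its mirror image.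
  ⋆-suc : ∀ n (f g : Series) → (f ⋆ g) (suc n) ≈ f (suc n) * g 0 + (f ⋆ (g ∘ suc)) n
  ⋆-suc zero    f g = solve 4 (λ a b x y → a :* y :+ (b :* x :+ con 0ℤ) := b :* x :+ (a :* y :+ con 0ℤ))
    refl (f 0) (f 1) (g 0) (g 1)
  ⋆-suc (suc n) f g = trans (+-congˡ (⋆-suc n (f ∘ suc) g))
    (solve 3 (λ x y z → x :+ (y :+ z) := y :+ (x :+ z)) refl _ _ _)

  ⋆-comm : ∀ f g → f ⋆ g ≋ g ⋆ f
  ⋆-comm f g zero    = +-congʳ (*-comm (f 0) (g 0))
  ⋆-comm f g (suc n) = begin
    f 0 * g (suc n) + ((f ∘ suc) ⋆ g) n   ≈⟨ +-cong (*-comm _ _) (⋆-comm (f ∘ suc) g n) ⟩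
    g (suc n) * f 0 + (g ⋆ (f ∘ suc)) n   ≈⟨ ⋆-suc n g f ⟨
    (g ⋆ f) (suc n)                       ∎

  ⋆-assoc : ∀ f g h → (f ⋆ g) ⋆ h ≋ f ⋆ (g ⋆ h)
  ⋆-assoc f g h zero    =
    solve 3 (λ x y z → (x :* y :+ con 0ℤ) :* z :+ con 0ℤ := x :* (y :* z :+ con 0ℤ) :+ con 0ℤ)
    refl (f 0) (g 0) (h 0)
  ⋆-assoc f g h (suc n) = begin
    (f 0 * g 0 + 0#) * h (suc n) + ((λ m → f 0 * g (suc m) + (f′ ⋆ g) m) ⋆ h) n
      ≈⟨ +-cong (*-congʳ (+-identityʳ _)) (⋆-distribʳ h (λ m → f 0 * g′ m) (f′ ⋆ g) n) ⟩
    f 0 * g 0 * h (suc n) + (((λ m → f 0 * g′ m) ⋆ h) n + ((f′ ⋆ g) ⋆ h) n)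
      ≈⟨ +-congˡ (+-cong (⋆-scaleˡ (f 0) g′ h n) (⋆-assoc f′ g h n)) ⟩
    f 0 * g 0 * h (suc n) + (f 0 * (g′ ⋆ h) n + (f′ ⋆ (g ⋆ h)) n)
      ≈⟨ solve 5 (λ x y z u v → x :* y :* z :+ (x :* u :+ v) := x :* (y :* z :+ u) :+ v) refl _ _ _ _ _ ⟩
    f 0 * (g 0 * h (suc n) + (g′ ⋆ h) n) + (f′ ⋆ (g ⋆ h)) n   ∎
    where
    f′ g′ : Series
    f′ = f ∘ suc
    g′ = g ∘ suc

  ⋆-constˡ : ∀ (f g : Series) → (∀ k → f (suc k) ≈ 0#) → f ⋆ g ≋ λ n → f 0 * g n
  ⋆-constˡ f g h zero    = ⋆-0 f g
  ⋆-constˡ f g h (suc n) =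
    trans (+-congˡ (∑<-zero (suc n) λ k → trans (*-congʳ {g (n ∸ k)} (h k)) (zeroˡ _))) (+-identityʳ _)

  ⋆-identityˡ : ∀ f → one ⋆ f ≋ f
  ⋆-identityˡ f n = trans (⋆-constˡ one f (λ _ → refl) n) (*-identityˡ (f n))

  seriesRing : CommutativeRing 0ℓ 0ℓ
  seriesRing = record
    { Carrier = Series
    ; _≈_ = _≋_
    ; _+_ = λ f g n → f n + g n
    ; _*_ = _⋆_
    ; -_ = λ f n → - f n
    ; 0# = λ _ → 0#
    ; 1# = one
    ; isCommutativeRing = record
      { isRing = record
        { +-isAbelianGroup = Pointwise.isAbelianGroup ℕ +-isAbelianGroup
        ; *-cong = ⋆-cong
        ; *-assoc = ⋆-assoc
        ; *-identity = ⋆-identityˡ , λ f n → trans (⋆-comm f one n) (⋆-identityˡ f n)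
        ; distrib = (λ h f g n → trans (⋆-comm h (λ n → f n + g n) n)
                       (trans (⋆-distribʳ h f g n) (+-cong (⋆-comm f h n) (⋆-comm g h n))))
                  , ⋆-distribʳ
        }
      ; *-comm = ⋆-comm
      }
    }

  -- For series in t: σ p is t ↦ p t, ℓ c is the linear factor 1 + c t, and spread is t ↦ t².
  σ : Carrier → Series → Series
  σ p f n = p ^ n * f n

  σ-cong : ∀ p {f g} → f ≋ g → σ p f ≋ σ p g
  σ-cong p h n = *-congˡ (h n)

  σ-base : ∀ {p q} → p ≈ q → ∀ f → σ p f ≋ σ q f
  σ-base h f n = *-congʳ (^-congˡ n h)

  σ-⋆ : ∀ p f g → σ p (f ⋆ g) ≋ σ p f ⋆ σ p g
  σ-⋆ p f g zero = solve 2 (λ x y → con 1ℤ :* (x :* y :+ con 0ℤ) := con 1ℤ :* x :* (con 1ℤ :* y) :+ con 0ℤ)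
    refl (f 0) (g 0)
  σ-⋆ p f g (suc n) = begin
    p * p ^ n * (f 0 * g (suc n) + (f′ ⋆ g) n)
      ≈⟨ solve 5 (λ p u x y z → p :* u :* (x :* y :+ z) :=
            con 1ℤ :* x :* (p :* u :* y) :+ p :* (u :* z)) refl _ _ _ _ _ ⟩
    1# * f 0 * σ p g (suc n) + p * σ p (f′ ⋆ g) n
      ≈⟨ +-congˡ (*-congˡ (σ-⋆ p f′ g n)) ⟩
    1# * f 0 * σ p g (suc n) + p * (σ p f′ ⋆ σ p g) n
      ≈⟨ +-congˡ (⋆-scaleˡ p (σ p f′) (σ p g) n) ⟨
    1# * f 0 * σ p g (suc n) + ((λ n → p * (p ^ n * f (suc n))) ⋆ σ p g) n
      ≈⟨ +-congˡ (⋆-cong (λ n → sym (*-assoc p (p ^ n) (f (suc n)))) (λ m → refl {σ p g m}) n) ⟩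
    1# * f 0 * σ p g (suc n) + ((λ n → p * p ^ n * f (suc n)) ⋆ σ p g) n   ∎
    where
    f′ : Series
    f′ = f ∘ suc

  σ-σ : ∀ p q f → σ p (σ q f) ≋ σ (p * q) f
  σ-σ p q f n = trans (sym (*-assoc (p ^ n) (q ^ n) (f n))) (*-congʳ (sym (^-distrib-* p q n)))

  ℓ : Carrier → Series
  ℓ c zero          = 1#
  ℓ c (suc zero)    = c
  ℓ c (suc (suc _)) = 0#

  ℓ-cong : ∀ {c d} → c ≈ d → ℓ c ≋ ℓ d
  ℓ-cong h zero          = refl
  ℓ-cong h (suc zero)    = h
  ℓ-cong h (suc (suc _)) = refl

  σ-ℓ : ∀ p c → σ p (ℓ c) ≋ ℓ (p * c)
  σ-ℓ p c zero          = *-identityˡ 1#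
  σ-ℓ p c (suc zero)    = *-congʳ (*-identityʳ p)
  σ-ℓ p c (suc (suc n)) = zeroʳ _

  ℓ⋆-0 : ∀ c f → (ℓ c ⋆ f) 0 ≈ f 0
  ℓ⋆-0 c f = trans (⋆-0 (ℓ c) f) (*-identityˡ (f 0))

  ℓ⋆-suc : ∀ c f n → (ℓ c ⋆ f) (suc n) ≈ f (suc n) + c * f n
  ℓ⋆-suc c f n = +-cong (*-identityˡ _) (⋆-constˡ (ℓ c ∘ suc) f (λ _ → refl) n)

  spread : Series → Series
  spread f zero          = f 0
  spread f (suc zero)    = 0#
  spread f (suc (suc n)) = spread (f ∘ suc) n

  spread-cong : ∀ {f g} → f ≋ g → spread f ≋ spread g
  spread-cong h zero          = h 0
  spread-cong h (suc zero)    = refl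
  spread-cong h (suc (suc n)) = spread-cong (h ∘ suc) n

  spread-0 : ∀ n → spread (λ _ → 0#) n ≈ 0#
  spread-0 zero          = refl
  spread-0 (suc zero)    = refl
  spread-0 (suc (suc n)) = spread-0 n

  spread-linear : ∀ x f g → spread (λ n → x * f n + g n) ≋ λ n → x * spread f n + spread g n
  spread-linear x f g zero          = refl
  spread-linear x f g (suc zero)    = sym (trans (+-identityʳ _) (zeroʳ x))
  spread-linear x f g (suc (suc n)) = spread-linear x (f ∘ suc) (g ∘ suc) n

  spread-⋆ : ∀ f g → spread (f ⋆ g) ≋ spread f ⋆ spread g
  spread-⋆ f g zero       = refl
  spread-⋆ f g (suc zero) = solve 2 (λ x y → con 0ℤ := x :* con 0ℤ :+ (con 0ℤ :* y :+ con 0ℤ)) refl (f 0) (g 0)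
  spread-⋆ f g (suc (suc n)) = begin
    spread (λ m → f 0 * g (suc m) + ((f ∘ suc) ⋆ g) m) n
      ≈⟨ spread-linear (f 0) (g ∘ suc) ((f ∘ suc) ⋆ g) n ⟩
    f 0 * spread (g ∘ suc) n + spread ((f ∘ suc) ⋆ g) n
      ≈⟨ +-congˡ (spread-⋆ (f ∘ suc) g n) ⟩
    f 0 * spread (g ∘ suc) n + (spread (f ∘ suc) ⋆ spread g) n
      -- The inserted zero is the contribution of the coefficient of `spread f` at index 1.
      ≈⟨ solve 3 (λ x y z → x :+ y := x :+ (con 0ℤ :* z :+ y)) refl _ _ (spread g (suc n)) ⟩
    f 0 * spread (g ∘ suc) n + (0# * spread g (suc n) + (spread (f ∘ suc) ⋆ spread g) n)   ∎

  -- Replacing t by p t multiplies t² by p², which is why the two scalings have different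
  -- parameters.
  σ-spread : ∀ p f → σ p (spread f) ≋ spread (σ (p * p) f)
  σ-spread p f zero          = refl
  σ-spread p f (suc zero)    = zeroʳ _
  σ-spread p f (suc (suc n)) = begin
    p * (p * p ^ n) * spread (f ∘ suc) n
      ≈⟨ solve 3 (λ p u x → p :* (p :* u) :* x := p :* p :* (u :* x) :+ con 0ℤ) refl p _ _ ⟩
    p * p * σ p (spread (f ∘ suc)) n + 0#
      ≈⟨ +-cong (*-congˡ (σ-spread p (f ∘ suc) n)) (sym (spread-0 n)) ⟩
    p * p * spread (σ (p * p) (f ∘ suc)) n + spread (λ _ → 0#) n
      ≈⟨ spread-linear (p * p) _ (λ _ → 0#) n ⟨
    spread (λ m → p * p * σ (p * p) (f ∘ suc) m + 0#) n
      ≈⟨ spread-cong (λ m → solve 3 (λ x u y → x :* (u :* y) :+ con 0ℤ := x :* u :* y) refl _ _ _) n ⟩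
    spread (σ (p * p) f ∘ suc) n   ∎

  ℓ-conjugate : ∀ c → ℓ c ⋆ ℓ (- c) ≋ spread (ℓ (- (c * c)))
  ℓ-conjugate c zero                      = solve 0 (con 1ℤ :* con 1ℤ :+ con 0ℤ := con 1ℤ) refl
  ℓ-conjugate c (suc zero)                = trans (ℓ⋆-suc c (ℓ (- c)) 0)
    (solve 1 (λ c → :- c :+ c :* con 1ℤ := con 0ℤ) refl c)
  ℓ-conjugate c (suc (suc zero))          = trans (ℓ⋆-suc c (ℓ (- c)) 1)
    (solve 1 (λ c → con 0ℤ :+ c :* :- c := :- (c :* c)) refl c)
  ℓ-conjugate c (suc (suc (suc zero)))    = trans (ℓ⋆-suc c (ℓ (- c)) 2)
    (solve 1 (λ c → con 0ℤ :+ c :* con 0ℤ := con 0ℤ) refl c)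
  ℓ-conjugate c (suc (suc (suc (suc n)))) = trans (ℓ⋆-suc c (ℓ (- c)) (3 ℕ.+ n))
    (trans (solve 1 (λ c → con 0ℤ :+ c :* con 0ℤ := con 0ℤ) refl c) (sym (spread-0 n)))

  -- A f(t) = B f(p t) determines f (suc n) times 1 - p ^ suc n from lower coefficients.
  σ-unique : ∀ p (A B f g : Series) → A 0 ≈ 1# → B 0 ≈ 1# →
             (∀ n x y → (1# - p ^ suc n) * x ≈ (1# - p ^ suc n) * y → x ≈ y) →
             A ⋆ f ≋ B ⋆ σ p f → A ⋆ g ≋ B ⋆ σ p g → f 0 ≈ g 0 → f ≋ g
  σ-unique p A B f g A0 B0 cancel hf hg f0 n = upTo n n ℕₚ.≤-refl
    where
    leading : ∀ n f → A ⋆ f ≋ B ⋆ σ p f →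
              (1# - p ^ suc n) * f (suc n) ≈ ((B ∘ suc) ⋆ σ p f) n - ((A ∘ suc) ⋆ f) n
    leading n f h = begin
      (1# - u) * x
        ≈⟨ solve 4 (λ u x a b → (con 1ℤ :- u) :* x := (con 1ℤ :* x :+ a) :- a :- con 1ℤ :* (u :* x)) refl u x a b ⟩
      (1# * x + a) - a - 1# * (u * x)
        ≈⟨ +-congʳ (+-congʳ (trans (trans (+-congʳ (*-congʳ (sym A0))) (h (suc n))) (+-congʳ (*-congʳ B0)))) ⟩
      (1# * (u * x) + b) - a - 1# * (u * x)
        ≈⟨ solve 4 (λ u x a b → (con 1ℤ :* (u :* x) :+ b) :- a :- con 1ℤ :* (u :* x) := b :- a) refl u x a b ⟩
      b - a                   ∎
      where
      u x a b : Carrier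
      u = p ^ suc n
      x = f (suc n)
      a = ((A ∘ suc) ⋆ f) n
      b = ((B ∘ suc) ⋆ σ p f) n
    -- The coefficient at k + 1 depends on all earlier ones; the bound `n` makes this strong
    -- induction a structural recursion.
    upTo : ∀ n k → k ≤ n → f k ≈ g k
    upTo n       zero    _         = f0
    upTo (suc n) (suc k) (s≤s k≤n) = cancel k _ _ (begin
      (1# - p ^ suc k) * f (suc k)                  ≈⟨ leading k f hf ⟩
      ((B ∘ suc) ⋆ σ p f) k - ((A ∘ suc) ⋆ f) k
        ≈⟨ +-cong (⋆-congˡ-≤ k {B ∘ suc} λ m m≤k → *-congˡ {p ^ m} (upTo n m (ℕₚ.≤-trans m≤k k≤n)))
                  (-‿cong (⋆-congˡ-≤ k {A ∘ suc} λ m m≤k → upTo n m (ℕₚ.≤-trans m≤k k≤n))) ⟩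
      ((B ∘ suc) ⋆ σ p g) k - ((A ∘ suc) ⋆ g) k     ≈⟨ leading k g hg ⟨
      (1# - p ^ suc k) * g (suc k)                  ∎)

-- Filtered rings and convergent sums.

double : ℕ → ℕ
double zero    = zero
double (suc n) = suc (suc (double n))

n≤double : ∀ n → n ≤ double n
n≤double zero    = z≤n
n≤double (suc n) = s≤s (ℕₚ.m≤n⇒m≤1+n (n≤double n))

-- A separated filtration, with sums ∑∞ of families whose k-th term has order at least k.
record Filtration (R : CommutativeRing 0ℓ 0ℓ) : Set₁ where
  open CommutativeRing R
  open PowerSeries R using (Series; ∑<)
  field
    Ord       : ℕ → Carrier → Set
    ord-≈     : ∀ {n x y} → x ≈ y → Ord n x → Ord n y
    ord-≤     : ∀ {m n x} → m ≤ n → Ord n x → Ord m x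
    ord-all   : ∀ x → Ord 0 x
    ord-0     : ∀ n → Ord n 0#
    ord-+     : ∀ {n x y} → Ord n x → Ord n y → Ord n (x + y)
    ord-neg   : ∀ {n x} → Ord n x → Ord n (- x)
    ord-*     : ∀ {m n x y} → Ord m x → Ord n y → Ord (m ℕ.+ n) (x * y)
    separated : ∀ {x} → (∀ n → Ord n x) → x ≈ 0#
    ∑∞        : Series → Carrier
    -- `B` and `m` are independent: the truncation error has the order of the discarded terms, which
    -- for shifted or rescaled families exceeds the number of terms kept.
    ∑∞-tail   : ∀ {m} B c → (∀ k → Ord k (c k)) → (∀ k → B ≤ k → Ord m (c k)) →
                Ord m (∑∞ c - ∑< B c)

module Summation {R : CommutativeRing 0ℓ 0ℓ} (Φ : Filtration R) where
  open CommutativeRing R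
  open Filtration Φ
  open PowerSeries R
  open Exp semiring using (_^_)
  open IntegerCoefficients R
  open SetoidReasoning setoid

  infix 4 _~[_]_

  _~[_]_ : Carrier → ℕ → Carrier → Set
  x ~[ n ] y = Ord n (x - y)

  ~-reflexive : ∀ {n x y} → x ≈ y → x ~[ n ] y
  ~-reflexive {n} {x} {y} h = ord-≈ (trans (sym (-‿inverseʳ y)) (+-congʳ (sym h))) (ord-0 n)

  ~-sym : ∀ {n x y} → x ~[ n ] y → y ~[ n ] x
  ~-sym {n} {x} {y} h = ord-≈ (solve 2 (λ x y → :- (x :- y) := y :- x) refl x y) (ord-neg h)

  ~-trans : ∀ {n x y z} → x ~[ n ] y → y ~[ n ] z → x ~[ n ] z
  ~-trans {n} {x} {y} {z} h k =
    ord-≈ (solve 3 (λ x y z → (x :- y) :+ (y :- z) := x :- z) refl x y z) (ord-+ h k)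

  ~-≤ : ∀ {m n x y} → m ≤ n → x ~[ n ] y → x ~[ m ] y
  ~-≤ = ord-≤

  ~-+ : ∀ {n x x′ y y′} → x ~[ n ] x′ → y ~[ n ] y′ → x + y ~[ n ] x′ + y′
  ~-+ {n} {x} {x′} {y} {y′} h k = ord-≈
    (solve 4 (λ x x′ y y′ → (x :- x′) :+ (y :- y′) := (x :+ y) :- (x′ :+ y′)) refl x x′ y y′) (ord-+ h k)

  ord-*ˡ : ∀ {n} x {y} → Ord n y → Ord n (x * y)
  ord-*ˡ x h = ord-* (ord-all x) h

  ~-* : ∀ {n x x′ y y′} → x ~[ n ] x′ → y ~[ n ] y′ → x * y ~[ n ] x′ * y′
  ~-* {n} {x} {x′} {y} {y′} h k = ord-≈
    (solve 4 (λ x x′ y y′ → y :* (x :- x′) :+ x′ :* (y :- y′) := x :* y :- x′ :* y′) refl x x′ y y′)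
    (ord-+ (ord-*ˡ y h) (ord-*ˡ x′ k))

  ~⇒≈ : ∀ {x y} → (∀ n → x ~[ n ] y) → x ≈ y
  ~⇒≈ {x} {y} h = begin
    x            ≈⟨ solve 2 (λ x y → x := (x :- y) :+ y) refl x y ⟩
    (x - y) + y  ≈⟨ +-congʳ (separated h) ⟩
    0# + y       ≈⟨ +-identityˡ y ⟩
    y            ∎

  -- x = u x + y with u of positive order: x is y / (1 - u), hence has the order of y.
  ord-solve : ∀ {n u x y} → Ord 1 u → x ≈ u * x + y → Ord n y → Ord n x
  ord-solve {n} {u} {x} {y} hu hx hy = upTo n ℕₚ.≤-refl
    where
    upTo : ∀ m → m ≤ n → Ord m x
    upTo zero    _   = ord-all x
    upTo (suc m) m<n = ord-≈ (sym hx) (ord-+ (ord-* hu (upTo m (ℕₚ.<⇒≤ m<n))) (ord-≤ m<n hy))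

  -- The difference d = x - y satisfies d = u d, so `ord-solve` gives it every order and separation
  -- makes it zero; no inverse of 1 - u is constructed.
  cancel-1- : ∀ {u x y} → Ord 1 u → (1# - u) * x ≈ (1# - u) * y → x ≈ y
  cancel-1- {u} {x} {y} hu h = ~⇒≈ λ n → ord-solve hu (begin
    x - y
      ≈⟨ solve 3 (λ u x y → x :- y := u :* (x :- y) :+ ((con 1ℤ :- u) :* x :- (con 1ℤ :- u) :* y)) refl u x y ⟩
    u * (x - y) + ((1# - u) * x - (1# - u) * y)   ≈⟨ +-congˡ (+-congʳ h) ⟩
    u * (x - y) + ((1# - u) * y - (1# - u) * y)   ≈⟨ +-congˡ (-‿inverseʳ _) ⟩
    u * (x - y) + 0#                              ∎) (ord-0 n)

  cancel-~1 : ∀ {v x y} → v ~[ 1 ] 1# → v * x ≈ v * y → x ≈ y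
  cancel-~1 {v} hv h = cancel-1- (~-sym hv) (trans (v≈ _) (trans h (sym (v≈ _))))
    where
    v≈ : ∀ x → (1# - (1# - v)) * x ≈ v * x
    v≈ x = solve 2 (λ v x → (con 1ℤ :- (con 1ℤ :- v)) :* x := v :* x) refl v x

  ord-^ : ∀ {x} → Ord 1 x → ∀ n → Ord n (x ^ n)
  ord-^ hx zero    = ord-all _
  ord-^ hx (suc n) = ord-* hx (ord-^ hx n)

  ord-^-suc : ∀ {x} → Ord 1 x → ∀ n → Ord 1 (x ^ suc n)
  ord-^-suc hx n = ord-≤ (s≤s z≤n) (ord-^ hx (suc n))

  ord-∑< : ∀ {m} n (c : Series) → (∀ k → k < n → Ord m (c k)) → Ord m (∑< n c)
  ord-∑< zero    c h = ord-0 _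
  ord-∑< (suc n) c h = ord-+ (h 0 (s≤s z≤n)) (ord-∑< n (c ∘ suc) λ k k<n → h (suc k) (s≤s k<n))

  ~-∑< : ∀ {m} n (c d : Series) → (∀ k → k < n → c k ~[ m ] d k) → ∑< n c ~[ m ] ∑< n d
  ~-∑< zero    c d h = ~-reflexive refl
  ~-∑< (suc n) c d h = ~-+ (h 0 (s≤s z≤n)) (~-∑< n (c ∘ suc) (d ∘ suc) λ k k<n → h (suc k) (s≤s k<n))

  Null : Series → Set
  Null c = ∀ k → Ord k (c k)

  Null-suc : ∀ {c} → Null c → Null (c ∘ suc)
  Null-suc h k = ord-≤ (ℕₚ.n≤1+n k) (h (suc k))

  Null-≋ : ∀ {c d} → c ≋ d → Null c → Null d
  Null-≋ c≋d h k = ord-≈ (c≋d k) (h k)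

  Null-*ˡ : ∀ (u c : Series) → Null c → Null (λ k → u k * c k)
  Null-*ˡ u c h k = ord-*ˡ (u k) (h k)

  Null-⋆ : ∀ {c d} → Null c → Null d → Null (c ⋆ d)
  Null-⋆ {c} {d} hc hd n = ord-∑< (suc n) (λ k → c k * d (n ∸ k)) λ { k (s≤s k≤n) →
    ≡.subst (λ m → Ord m (c k * d (n ∸ k))) (ℕₚ.m+[n∸m]≡n k≤n) (ord-* (hc k) (hd (n ∸ k))) }

  ∑∞-~ : ∀ {c} → Null c → ∀ n → ∑∞ c ~[ n ] ∑< n c
  ∑∞-~ {c} h n = ∑∞-tail n c h λ k n≤k → ord-≤ n≤k (h k)

  ∑∞-unique : ∀ {c x} → Null c → (∀ n → x ~[ n ] ∑< n c) → x ≈ ∑∞ c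
  ∑∞-unique hc h = ~⇒≈ λ n → ~-trans (h n) (~-sym (∑∞-~ hc n))

  ∑∞-cong : ∀ {c d} → Null c → c ≋ d → ∑∞ c ≈ ∑∞ d
  ∑∞-cong {c} hc c≋d = ∑∞-unique (Null-≋ c≋d hc) λ n →
    ~-trans (∑∞-~ hc n) (~-reflexive (∑<-cong n c≋d))

  ∑∞-+ : ∀ {c d} → Null c → Null d → ∑∞ (λ k → c k + d k) ≈ ∑∞ c + ∑∞ d
  ∑∞-+ {c} {d} hc hd = sym (∑∞-unique (λ k → ord-+ (hc k) (hd k)) λ n →
    ~-trans (~-+ (∑∞-~ hc n) (∑∞-~ hd n)) (~-reflexive (sym (∑<-+ n c d))))

  ∑∞-* : ∀ x {c} → Null c → ∑∞ (λ k → x * c k) ≈ x * ∑∞ c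
  ∑∞-* x {c} hc = sym (∑∞-unique (Null-*ˡ (λ _ → x) c hc) λ n →
    ~-trans (~-* (~-reflexive refl) (∑∞-~ hc n)) (~-reflexive (sym (∑<-* n x c))))

  ∑∞-suc : ∀ {c} → Null c → ∑∞ c ≈ c 0 + ∑∞ (c ∘ suc)
  ∑∞-suc {c} hc = sym (∑∞-unique hc tail)
    where
    tail : ∀ n → c 0 + ∑∞ (c ∘ suc) ~[ n ] ∑< n c
    tail zero    = ord-all _
    -- `Null-suc` alone would give an error of order n; the discarded terms are c (k + 1) with k ≥
    -- n, which supply the missing order.
    tail (suc n) = ~-+ (~-reflexive refl)
      (∑∞-tail n (c ∘ suc) (Null-suc hc) λ k n≤k → ord-≤ (s≤s n≤k) (hc (suc k)))

  ord-∑∞ : ∀ {m c} → Null c → (∀ k → Ord m (c k)) → Ord m (∑∞ c)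
  ord-∑∞ {m} {c} hc h = ord-≈ (solve 1 (λ x → x :- con 0ℤ := x) refl (∑∞ c)) (∑∞-tail 0 c hc λ k _ → h k)

  diagonal : (ℕ → Series) → Series
  diagonal F n = ∑< (suc n) (λ i → F i (n ∸ i))

  -- Both sides add F i k over the triangle i + k < n; the induction strips row 0.
  ∑<-diagonal : ∀ n (F : ℕ → Series) → ∑< n (diagonal F) ≈ ∑< n (λ i → ∑< (n ∸ i) (F i))
  ∑<-diagonal zero    F = refl
  ∑<-diagonal (suc n) F = begin
    F 0 0 + 0# + ∑< n (λ k → F 0 (suc k) + diagonal (F ∘ suc) k)
      ≈⟨ +-congˡ (∑<-+ n (F 0 ∘ suc) (diagonal (F ∘ suc))) ⟩
    F 0 0 + 0# + (∑< n (F 0 ∘ suc) + ∑< n (diagonal (F ∘ suc)))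
      ≈⟨ solve 3 (λ x y z → x :+ con 0ℤ :+ (y :+ z) := x :+ y :+ z) refl _ _ _ ⟩
    F 0 0 + ∑< n (F 0 ∘ suc) + ∑< n (diagonal (F ∘ suc))
      ≈⟨ +-congˡ (∑<-diagonal n (F ∘ suc)) ⟩
    F 0 0 + ∑< n (F 0 ∘ suc) + ∑< n (λ i → ∑< (n ∸ i) (F (suc i)))   ∎

  -- Cutting row i after n - i entries discards only terms with i + k ≥ n, hence of order n, so both
  -- sides agree to order n with the same finite triangle.
  ∑∞-diagonal : ∀ (F : ℕ → Series) → (∀ i k → Ord (i ℕ.+ k) (F i k)) →
                ∑∞ (diagonal F) ≈ ∑∞ (λ i → ∑∞ (F i))
  ∑∞-diagonal F hF = sym (∑∞-unique diagonal-null λ n →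
    ~-trans (∑∞-~ rows-null n)
      (~-trans (~-∑< n (λ i → ∑∞ (F i)) (λ i → ∑< (n ∸ i) (F i)) (λ i i<n → row n i (ℕₚ.<⇒≤ i<n)))
        (~-reflexive (sym (∑<-diagonal n F)))))
    where
    row-null : ∀ i → Null (F i)
    row-null i k = ord-≤ (ℕₚ.m≤n+m k i) (hF i k)
    rows-null : Null (λ i → ∑∞ (F i))
    rows-null i = ord-∑∞ (row-null i) λ k → ord-≤ (ℕₚ.m≤m+n i k) (hF i k)
    diagonal-null : Null (diagonal F)
    diagonal-null n = ord-∑< (suc n) (λ i → F i (n ∸ i)) λ { i (s≤s i≤n) →
      ≡.subst (λ m → Ord m (F i (n ∸ i))) (ℕₚ.m+[n∸m]≡n i≤n) (hF i (n ∸ i)) }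
    row : ∀ n i → i ≤ n → ∑∞ (F i) ~[ n ] ∑< (n ∸ i) (F i)
    row n i i≤n = ∑∞-tail (n ∸ i) (F i) (row-null i) λ k n∸i≤k →
      ord-≤ (≡.subst (_≤ i ℕ.+ k) (ℕₚ.m+[n∸m]≡n i≤n) (ℕₚ.+-monoʳ-≤ i n∸i≤k)) (hF i k)

  -- The weight sees only the total exponent i + k of t, so summing the Cauchy product along
  -- antidiagonals is a double sum. This is how weighted coefficients of a product of generating
  -- functions become multiple sums.
  ∑∞-⋆ : ∀ (w c d : Series) → Null c → Null d →
         ∑∞ (λ n → w n * (c ⋆ d) n) ≈ ∑∞ (λ i → ∑∞ (λ k → w (i ℕ.+ k) * c i * d k))
  ∑∞-⋆ w c d hc hd = trans (∑∞-cong (Null-*ˡ w (c ⋆ d) (Null-⋆ hc hd)) terms) (∑∞-diagonal F F-ord)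
    where
    F : ℕ → Series
    F i k = w (i ℕ.+ k) * c i * d k
    F-ord : ∀ i k → Ord (i ℕ.+ k) (F i k)
    F-ord i k = ord-* (ord-*ˡ (w (i ℕ.+ k)) (hc i)) (hd k)
    terms : (λ n → w n * (c ⋆ d) n) ≋ diagonal F
    terms n = trans (sym (∑<-* (suc n) (w n) (λ k → c k * d (n ∸ k)))) (∑<-cong-< (suc n) λ { k (s≤s k≤n) →
      trans (sym (*-assoc (w n) (c k) (d (n ∸ k))))
        (*-congʳ (*-congʳ (reflexive (≡.cong w (≡.sym (ℕₚ.m+[n∸m]≡n k≤n)))))) })

  -- The offset `m` carries the order already gained, so that the induction can pass to `v ∘ suc`,
  -- whose terms have order two higher.
  ord-spread : ∀ m {v} → (∀ l → Ord (m ℕ.+ double l) (v l)) → ∀ n → Ord (m ℕ.+ n) (spread v n)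
  ord-spread m h zero          = h 0
  ord-spread m h (suc zero)    = ord-0 _
  ord-spread m {v} h (suc (suc n)) = ≡.subst (λ k → Ord k (spread (v ∘ suc) n)) (shift n)
    (ord-spread (2 ℕ.+ m) (λ l → ≡.subst (λ k → Ord k (v (suc l))) (≡.sym (shift (double l))) (h (suc l))) n)
    where
    shift : ∀ n → 2 ℕ.+ m ℕ.+ n ≡ m ℕ.+ (2 ℕ.+ n)
    shift n = ≡.trans (≡.cong suc (≡.sym (ℕₚ.+-suc m n))) (≡.sym (ℕₚ.+-suc m (suc n)))

  -- `double` recurses by two successors in step with `spread`: each round consumes one even and one
  -- odd index, and the odd one contributes zero.
  ∑<-spread : ∀ n (w v : Series) → ∑< (double n) (λ m → w m * spread v m) ≈ ∑< n (λ l → w (double l) * v l)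
  ∑<-spread zero    w v = refl
  ∑<-spread (suc n) w v =
    +-congˡ (trans (+-cong (zeroʳ (w 1)) (∑<-spread n (w ∘ suc ∘ suc) (v ∘ suc))) (+-identityˡ _))

  ∑∞-spread : ∀ (w v : Series) → (∀ l → Ord (double l) (v l)) →
              ∑∞ (λ m → w m * spread v m) ≈ ∑∞ (λ l → w (double l) * v l)
  ∑∞-spread w v hv = sym (~⇒≈ λ n → ~-trans (∑∞-~ short n) (~-trans (~-reflexive (sym (∑<-spread n w v)))
    (~-sym (~-≤ (n≤double n) (∑∞-~ long (double n))))))
    where
    short : Null (λ l → w (double l) * v l)
    short l = ord-*ˡ (w (double l)) (ord-≤ (n≤double l) (hv l))
    long : Null (λ m → w m * spread v m)
    long = Null-*ˡ w (spread v) (ord-spread 0 hv)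

  -- Limits, q-products and Euler's two expansions.

  Lim : Series → Carrier → Set
  Lim s x = ∀ n → x ~[ n ] s n

  Lim-≈ : ∀ {s s′ x y} → Lim s x → Lim s′ y → (∀ n → s n ≈ s′ n) → x ≈ y
  Lim-≈ h k e = ~⇒≈ λ n → ~-trans (h n) (~-trans (~-reflexive (e n)) (~-sym (k n)))

  Lim-* : ∀ {s s′ x y} → Lim s x → Lim s′ y → Lim (λ n → s n * s′ n) (x * y)
  Lim-* h k n = ~-* (h n) (k n)

  Lim-double : ∀ {s x} → Lim s x → Lim (s ∘ double) x
  Lim-double h n = ~-≤ (n≤double n) (h (double n))

  poch : Carrier → Carrier → ℕ → Carrier
  poch x Q zero    = 1#
  poch x Q (suc m) = (1# - x * Q ^ m) * poch x Q m

  poch-~1 : ∀ {x Q v} → Ord 1 x → Lim (poch x Q) v → v ~[ 1 ] 1#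
  poch-~1 {x} {Q} hx h =
    -- Already the first partial product, 1 - x, agrees with the limit to order 1.
    ~-trans (h 1) (ord-≈ (solve 1 (λ x → :- x := (con 1ℤ :- x :* con 1ℤ) :* con 1ℤ :- con 1ℤ) refl x) (ord-neg hx))

  -- This is (1 + c t) f(t) evaluated at t = 1; the positive order of c keeps the coefficients of
  -- the product null.
  ∑∞-ℓ⋆ : ∀ c {f} → Null f → Ord 1 c → ∑∞ (ℓ c ⋆ f) ≈ (1# + c) * ∑∞ f
  ∑∞-ℓ⋆ c {f} hf hc = begin
    ∑∞ (ℓ c ⋆ f)                             ≈⟨ ∑∞-suc null ⟩
    (ℓ c ⋆ f) 0 + ∑∞ ((ℓ c ⋆ f) ∘ suc)
      ≈⟨ +-cong (ℓ⋆-0 c f) (∑∞-cong (Null-suc null) (ℓ⋆-suc c f)) ⟩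
    f 0 + ∑∞ (λ n → f (suc n) + c * f n)     ≈⟨ +-congˡ (∑∞-+ (Null-suc hf) (Null-*ˡ (λ _ → c) f hf)) ⟩
    f 0 + (∑∞ (f ∘ suc) + ∑∞ (λ n → c * f n))   ≈⟨ +-assoc _ _ _ ⟨
    f 0 + ∑∞ (f ∘ suc) + ∑∞ (λ n → c * f n)  ≈⟨ +-cong (sym (∑∞-suc hf)) (∑∞-* c hf) ⟩
    ∑∞ f + c * ∑∞ f
      ≈⟨ solve 2 (λ c s → s :+ c :* s := (con 1ℤ :+ c) :* s) refl c (∑∞ f) ⟩
    (1# + c) * ∑∞ f                          ∎
    where
    null : Null (ℓ c ⋆ f)
    null zero    = ord-all _
    null (suc n) = ord-≈ (sym (ℓ⋆-suc c f n)) (ord-+ (hf (suc n)) (ord-* hc (hf n)))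

  -- The coefficients of (- a t ; Q)∞, characterised by h(t) = (1 + a t) h(Q t).
  record IsEuler (Q a : Carrier) (h : Series) : Set where
    field
      head : h 0 ≈ 1#
      step : ∀ n → h (suc n) ≈ Q ^ suc n * h (suc n) + a * (Q ^ n * h n)

    functional : h ≋ ℓ a ⋆ σ Q h
    functional zero    = sym (trans (ℓ⋆-0 a (σ Q h)) (*-identityˡ _))
    functional (suc n) = trans (step n) (sym (ℓ⋆-suc a (σ Q h) n))

    null : Ord 1 Q → Ord 1 a → Null h
    null hQ ha zero    = ord-all _
    null hQ ha (suc n) = ord-solve (ord-^-suc hQ n) (step n) (ord-* ha (ord-*ˡ (Q ^ n) (null hQ ha n)))

  -- The coefficients of 1 / (c t ; Q)∞, characterised by (1 - c t) r(t) = r(Q t).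
  record IsInverse (Q c : Carrier) (r : Series) : Set where
    field
      head : r 0 ≈ 1#
      step : ∀ n → r (suc n) ≈ Q ^ suc n * r (suc n) + c * r n

    functional : ℓ (- c) ⋆ r ≋ σ Q r
    functional zero    = trans (ℓ⋆-0 (- c) r) (sym (*-identityˡ _))
    functional (suc n) = trans (ℓ⋆-suc (- c) r n) (trans (+-congʳ (step n))
      (solve 4 (λ y x c z → y :* x :+ c :* z :+ :- c :* z := y :* x) refl _ _ c (r n)))

    null : Ord 1 Q → Ord 1 c → Null r
    null hQ hc zero    = ord-all _
    null hQ hc (suc n) = ord-solve (ord-^-suc hQ n) (step n) (ord-* hc (null hQ hc n))

    -- With c of order 2 the coefficient at l has order 2 l, so it may be moved to t^(2l) by
    -- `spread` and the resulting series is still null.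
    double-null : Ord 1 Q → Ord 2 c → ∀ l → Ord (double l) (r l)
    double-null hQ hc zero    = ord-all _
    double-null hQ hc (suc n) = ord-solve (ord-^-suc hQ n) (step n) (ord-* hc (double-null hQ hc n))

  module Euler {Q a : Carrier} {h : Series} (hQ : Ord 1 Q) (ha : Ord 1 a) (H : IsEuler Q a h) where
    open IsEuler H

    -- The value of h at t = Q^m, that is, the product (-a Q^m; Q)∞ left after removing m factors.
    tail : ℕ → Carrier
    tail m = ∑∞ (σ (Q ^ m) h)

    tail-null : ∀ m → Null (σ (Q ^ m) h)
    tail-null m = Null-*ˡ (λ j → (Q ^ m) ^ j) h (null hQ ha)

    tail-suc : ∀ m → tail m ≈ (1# + a * Q ^ m) * tail (suc m)
    tail-suc m = trans (∑∞-cong (tail-null m) shifted)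
      (trans (∑∞-ℓ⋆ (y * a) (tail-null (suc m)) (ord-*ˡ y ha)) (*-congʳ (+-congˡ (*-comm y a))))
      where
      y : Carrier
      y = Q ^ m
      shifted : σ y h ≋ ℓ (y * a) ⋆ σ (Q * y) h
      shifted n = begin
        σ y h n                          ≈⟨ σ-cong y functional n ⟩
        σ y (ℓ a ⋆ σ Q h) n              ≈⟨ σ-⋆ y (ℓ a) (σ Q h) n ⟩
        (σ y (ℓ a) ⋆ σ y (σ Q h)) n
          ≈⟨ ⋆-cong (σ-ℓ y a) (λ k → trans (σ-σ y Q h k) (σ-base (*-comm y Q) h k)) n ⟩
        (ℓ (y * a) ⋆ σ (Q * y) h) n      ∎

    -- The relation (-a Q^m; Q)∞ = (-a; Q)∞ / (-a; Q)ₘ, kept free of division.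
    poch-tail : ∀ m → poch (- a) Q m * tail m ≈ tail 0
    poch-tail zero    = *-identityˡ _
    poch-tail (suc m) = begin
      (1# - (- a) * Q ^ m) * poch (- a) Q m * tail (suc m)
        ≈⟨ solve 4 (λ a u z t → (con 1ℤ :- (:- a) :* u) :* z :* t :=
              z :* ((con 1ℤ :+ a :* u) :* t)) refl a (Q ^ m) _ _ ⟩
      poch (- a) Q m * ((1# + a * Q ^ m) * tail (suc m))   ≈⟨ *-congˡ (tail-suc m) ⟨
      poch (- a) Q m * tail m                              ≈⟨ poch-tail m ⟩
      tail 0                                               ∎

    -- Every term but the constant one contains the factor Q^m, of order m.
    tail-~1 : ∀ m → tail m ~[ m ] 1#
    tail-~1 m = ~-trans (∑∞-tail 1 (σ (Q ^ m) h) (tail-null m) high)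
      (~-reflexive (trans (+-identityʳ _) (trans (*-identityˡ _) head)))
      where
      high : ∀ k → 1 ≤ k → Ord m (σ (Q ^ m) h k)
      high (suc k) _ =
        ord-≈ (*-comm _ _) (ord-*ˡ (h (suc k)) (ord-≈ (*-comm _ _) (ord-*ˡ ((Q ^ m) ^ k) (ord-^ hQ m))))

    sum≈tail : ∑∞ h ≈ tail 0
    sum≈tail = ∑∞-cong (null hQ ha) λ j → sym (trans (*-congʳ (1^ j)) (*-identityˡ _))
      where
      1^ : ∀ j → 1# ^ j ≈ 1#
      1^ zero    = refl
      1^ (suc j) = trans (*-identityˡ _) (1^ j)

    -- Euler's expansion of (-a; Q)∞: the sum is the n-th partial product times a tail that tends to
    -- 1.
    sum-poch : Lim (poch (- a) Q) (∑∞ h)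
    sum-poch n = ~-trans (~-reflexive (trans sum≈tail (sym (poch-tail n))))
      (~-trans (~-* (~-reflexive refl) (tail-~1 n)) (~-reflexive (*-identityʳ _)))

-- Combining functional equations in t.

module FunctionalEquations (T : CommutativeRing 0ℓ 0ℓ) where
  open CommutativeRing T
  open IntegerCoefficients T
  open SetoidReasoning setoid

  product-equation : ∀ {A B₁ B₂ α α′ β β′ v v′} → α ≈ B₁ * α′ → β ≈ B₂ * β′ → A * v ≈ v′ →
                     A * (α * (β * v)) ≈ (B₁ * B₂) * (α′ * (β′ * v′))
  product-equation {A} {B₁} {B₂} {α} {α′} {β} {β′} {v} {v′} hα hβ hv = begin
    A * (α * (β * v))   ≈⟨ solve 4 (λ A α β v → A :* (α :* (β :* v)) := α :* (β :* (A :* v))) refl A α β v ⟩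
    α * (β * (A * v))   ≈⟨ *-cong hα (*-cong hβ hv) ⟩
    (B₁ * α′) * ((B₂ * β′) * v′)
      ≈⟨ solve 5 (λ B₁ B₂ α β v → (B₁ :* α) :* ((B₂ :* β) :* v) :=
            (B₁ :* B₂) :* (α :* (β :* v))) refl B₁ B₂ α′ β′ v′ ⟩
    (B₁ * B₂) * (α′ * (β′ * v′))   ∎

  -- n = 1 - p t belongs to the equation of r = 1/(p t; p)∞. Its conjugate m = 1 + p t completes it
  -- to A₂ = 1 - p² t², at the cost of a factor m on the right.
  quotient-equation : ∀ {m n A₁ A₂ B r r′ e e′} → m * n ≈ A₂ → n * r ≈ r′ → A₁ * e ≈ B * e′ →
                      (A₁ * A₂) * (r * e) ≈ (B * m) * (r′ * e′)
  quotient-equation {m} {n} {A₁} {A₂} {B} {r} {r′} {e} {e′} hA hr he = begin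
    (A₁ * A₂) * (r * e)         ≈⟨ *-congʳ (*-congˡ hA) ⟨
    (A₁ * (m * n)) * (r * e)
      ≈⟨ solve 5 (λ A m n r e → (A :* (m :* n)) :* (r :* e) := m :* (n :* r) :* (A :* e)) refl A₁ m n r e ⟩
    m * (n * r) * (A₁ * e)      ≈⟨ *-cong (*-congˡ hr) he ⟩
    m * r′ * (B * e′)
      ≈⟨ solve 4 (λ m r B e → m :* r :* (B :* e) := (B :* m) :* (r :* e)) refl m r′ B e′ ⟩
    (B * m) * (r′ * e′)         ∎

  -- v = 1/(p t²; p)∞ loses two factors when t becomes p t, since t² is multiplied by p²: `v′` has
  -- lost the first and `v″` both. The q-product u loses three, since p = q³.
  double-sum-equation : ∀ {A₁ A₂ B₁ B₂ B₃ u u′ v v′ v″} →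
    u ≈ B₁ * (B₂ * (B₃ * u′)) → A₁ * v ≈ v′ → A₂ * v′ ≈ v″ →
    (A₁ * A₂) * (u * v) ≈ ((B₁ * B₃) * B₂) * (u′ * v″)
  double-sum-equation {A₁} {A₂} {B₁} {B₂} {B₃} {u} {u′} {v} {v′} {v″} hu hv hv′ = begin
    (A₁ * A₂) * (u * v)
      ≈⟨ solve 4 (λ A A′ u v → (A :* A′) :* (u :* v) := u :* (A′ :* (A :* v))) refl A₁ A₂ u v ⟩
    u * (A₂ * (A₁ * v))         ≈⟨ *-cong hu (trans (*-congˡ hv) hv′) ⟩
    B₁ * (B₂ * (B₃ * u′)) * v″
      ≈⟨ solve 5 (λ B₁ B₂ B₃ u v → B₁ :* (B₂ :* (B₃ :* u)) :* v :=
            ((B₁ :* B₃) :* B₂) :* (u :* v)) refl B₁ B₂ B₃ u′ v″ ⟩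
    ((B₁ * B₃) * B₂) * (u′ * v″)   ∎

  -- Meant for B₂ equal to L after the shift: then B₂ y is the shift of L x, and L takes the place
  -- of B₂ among the linear factors.
  extended-equation : ∀ {A L B₁ B₂ B₃ x y} → A * x ≈ ((B₁ * B₃) * B₂) * y →
                      A * (L * x) ≈ ((B₃ * L) * B₁) * (B₂ * y)
  extended-equation {A} {L} {B₁} {B₂} {B₃} {x} {y} h = begin
    A * (L * x)                       ≈⟨ solve 3 (λ A L x → A :* (L :* x) := L :* (A :* x)) refl A L x ⟩
    L * (A * x)                       ≈⟨ *-congˡ h ⟩
    L * (((B₁ * B₃) * B₂) * y)
      ≈⟨ solve 5 (λ L B₁ B₂ B₃ y → L :* (((B₁ :* B₃) :* B₂) :* y) :=
            ((B₃ :* L) :* B₁) :* (B₂ :* y)) refl L B₁ B₂ B₃ y ⟩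
    ((B₃ * L) * B₁) * (B₂ * y)        ∎

-- Series lemmas for the sums over a filtered ring.

module Capparelli {R : CommutativeRing 0ℓ 0ℓ} (Φ : Filtration R) where
  open CommutativeRing R
  open Filtration Φ
  open PowerSeries R
  open Summation Φ
  open RingProperties ring using (-‿distribʳ-*)
  open Exp semiring using (_^_; ^-homo-*; ^-congˡ)
  open CommutativeExp commutativeSemiring using (^-distrib-*)
  open IntegerCoefficients R
  open SetoidReasoning setoid
  open FunctionalEquations seriesRing
  private
    module T = CommutativeRing seriesRing

  spread-inverse : ∀ {p c v} → IsInverse (p * p) c v → spread (ℓ (- c)) ⋆ spread v ≋ σ p (spread v)
  spread-inverse {p} {c} {v} V n = begin
    (spread (ℓ (- c)) ⋆ spread v) n   ≈⟨ spread-⋆ (ℓ (- c)) v n ⟨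
    spread (ℓ (- c) ⋆ v) n            ≈⟨ spread-cong (IsInverse.functional V) n ⟩
    spread (σ (p * p) v) n            ≈⟨ σ-spread p v n ⟨
    σ p (spread v) n                  ∎

  ℓℓ⋆-1 : ∀ a b f → ((ℓ a ⋆ ℓ b) ⋆ f) 1 ≈ f 1 + (a + b) * f 0
  ℓℓ⋆-1 a b f = begin
    ((ℓ a ⋆ ℓ b) ⋆ f) 1           ≈⟨ ⋆-assoc (ℓ a) (ℓ b) f 1 ⟩
    (ℓ a ⋆ (ℓ b ⋆ f)) 1           ≈⟨ ℓ⋆-suc a (ℓ b ⋆ f) 0 ⟩
    (ℓ b ⋆ f) 1 + a * (ℓ b ⋆ f) 0   ≈⟨ +-cong (ℓ⋆-suc b f 0) (*-congˡ (ℓ⋆-0 b f)) ⟩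
    f 1 + b * f 0 + a * f 0
      ≈⟨ solve 4 (λ a b x y → x :+ b :* y :+ a :* y := x :+ (a :+ b) :* y) refl a b _ _ ⟩
    f 1 + (a + b) * f 0           ∎

  ℓℓ⋆-2+ : ∀ a b f n → ((ℓ a ⋆ ℓ b) ⋆ f) (2 ℕ.+ n) ≈ f (2 ℕ.+ n) + (a + b) * f (1 ℕ.+ n) + a * b * f n
  ℓℓ⋆-2+ a b f n = begin
    ((ℓ a ⋆ ℓ b) ⋆ f) (2 ℕ.+ n)   ≈⟨ ⋆-assoc (ℓ a) (ℓ b) f (2 ℕ.+ n) ⟩
    (ℓ a ⋆ (ℓ b ⋆ f)) (2 ℕ.+ n)   ≈⟨ ℓ⋆-suc a (ℓ b ⋆ f) (1 ℕ.+ n) ⟩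
    (ℓ b ⋆ f) (2 ℕ.+ n) + a * (ℓ b ⋆ f) (1 ℕ.+ n)
      ≈⟨ +-cong (ℓ⋆-suc b f (1 ℕ.+ n)) (*-congˡ (ℓ⋆-suc b f n)) ⟩
    f (2 ℕ.+ n) + b * f (1 ℕ.+ n) + a * (f (1 ℕ.+ n) + b * f n)
      ≈⟨ solve 5 (λ a b x y z → x :+ b :* y :+ a :* (y :+ b :* z) :=
            x :+ (a :+ b) :* y :+ a :* b :* z) refl a b _ _ _ ⟩
    f (2 ℕ.+ n) + (a + b) * f (1 ℕ.+ n) + a * b * f n   ∎

  spread-ℓ⋆-1 : ∀ c f → (spread (ℓ c) ⋆ f) 1 ≈ f 1
  spread-ℓ⋆-1 c f = solve 2 (λ x y → con 1ℤ :* x :+ (con 0ℤ :* y :+ con 0ℤ) := x) refl (f 1) (f 0)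

  spread-ℓ⋆-2+ : ∀ c f n → (spread (ℓ c) ⋆ f) (2 ℕ.+ n) ≈ f (2 ℕ.+ n) + c * f n
  spread-ℓ⋆-2+ c f n =
    +-cong (*-identityˡ _) (trans (+-cong (zeroˡ _) (⋆-constˡ (spread (ℓ c ∘ suc)) f high n)) (+-identityˡ _))
    where
    high : ∀ k → spread (ℓ c ∘ suc) (suc k) ≈ 0#
    high zero    = refl
    high (suc k) = spread-0 k

  poch-cong : ∀ {x y P Q} → x ≈ y → P ≈ Q → ∀ n → poch x P n ≈ poch y Q n
  poch-cong h k zero    = refl
  poch-cong h k (suc n) = *-cong (+-congˡ (-‿cong (*-cong h (^-congˡ n k)))) (poch-cong h k n)

  poch-finite-~1 : ∀ {x} Q → Ord 1 x → ∀ n → poch x Q n ~[ 1 ] 1#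
  poch-finite-~1 {x} Q hx zero    = ~-reflexive refl
  poch-finite-~1 {x} Q hx (suc n) = ~-trans (~-* factor (poch-finite-~1 Q hx n)) (~-reflexive (*-identityˡ 1#))
    where
    factor : 1# - x * Q ^ n ~[ 1 ] 1#
    factor =
      ord-≈ (solve 2 (λ x u → u :* :- x := (con 1ℤ :- x :* u) :- con 1ℤ) refl x (Q ^ n)) (ord-*ˡ (Q ^ n) (ord-neg hx))

  -- Multiplied by (Q; Q)ₙ, the recurrence becomes the ratio rule for E, because (Q; Q)ₙ₊₁ has the
  -- one further factor 1 - Q^(n+1). The multiplier is 1 to first order and can be cancelled.
  euler-quotient : ∀ {Q a} {E h : Series} → Ord 1 Q → E 0 ≈ 1# → (∀ n → E (suc n) ≈ a * (Q ^ n * E n)) →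
                   (∀ n → h n * poch Q Q n ≈ E n) → IsEuler Q a h
  euler-quotient {Q} {a} {E} {h} hQ E0 E-suc quotient = record
    { head = trans (sym (*-identityʳ _)) (trans (quotient 0) E0)
    ; step = λ n → cancel-~1 (poch-finite-~1 Q hQ n) (begin
        d n * h (suc n)
          ≈⟨ solve 3 (λ d U x → d :* x :=
                U :* (d :* x) :+ x :* ((con 1ℤ :- U) :* d)) refl (d n) (Q ^ suc n) (h (suc n)) ⟩
        Q ^ suc n * (d n * h (suc n)) + h (suc n) * d (suc n)
          ≈⟨ +-congˡ (trans (quotient (suc n)) (trans (E-suc n) (*-congˡ (*-congˡ (sym (quotient n)))))) ⟩
        Q ^ suc n * (d n * h (suc n)) + a * (Q ^ n * (h n * d n))
          ≈⟨ solve 6 (λ U d x a u y → U :* (d :* x) :+ a :* (u :* (y :* d)) := d :* (U :* x :+ a :* (u :* y))) refl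
               (Q ^ suc n) (d n) (h (suc n)) a (Q ^ n) (h n) ⟩
        d n * (Q ^ suc n * h (suc n) + a * (Q ^ n * h n))   ∎)
    }
    where
    d : Series
    d = poch Q Q

  inverse-quotient : ∀ {Q c} {E r : Series} → Ord 1 Q → E 0 ≈ 1# → (∀ n → E (suc n) ≈ c * E n) →
                     (∀ n → r n * poch Q Q n ≈ E n) → IsInverse Q c r
  inverse-quotient {Q} {c} {E} {r} hQ E0 E-suc quotient = record
    { head = trans (sym (*-identityʳ _)) (trans (quotient 0) E0)
    ; step = λ n → cancel-~1 (poch-finite-~1 Q hQ n) (begin
        d n * r (suc n)
          ≈⟨ solve 3 (λ d U x → d :* x :=
                U :* (d :* x) :+ x :* ((con 1ℤ :- U) :* d)) refl (d n) (Q ^ suc n) (r (suc n)) ⟩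
        Q ^ suc n * (d n * r (suc n)) + r (suc n) * d (suc n)
          ≈⟨ +-congˡ (trans (quotient (suc n)) (trans (E-suc n) (*-congˡ (sym (quotient n))))) ⟩
        Q ^ suc n * (d n * r (suc n)) + c * (r n * d n)
          ≈⟨ solve 5 (λ U d x c y → U :* (d :* x) :+ c :* (y :* d) := d :* (U :* x :+ c :* y)) refl
               (Q ^ suc n) (d n) (r (suc n)) c (r n) ⟩
        d n * (Q ^ suc n * r (suc n) + c * r n)   ∎)
    }
    where
    d : Series
    d = poch Q Q

  IsEuler-base : ∀ {P Q a h} → P ≈ Q → IsEuler P a h → IsEuler Q a h
  IsEuler-base {P} {Q} {a} {h} P≈Q H = record
    { head = IsEuler.head H
    ; step =
      λ n → trans (IsEuler.step H n) (+-cong (*-congʳ (^-congˡ (suc n) P≈Q)) (*-congˡ (*-congʳ (^-congˡ n P≈Q))))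
    }

  IsInverse-base : ∀ {P Q c r} → P ≈ Q → IsInverse P c r → IsInverse Q c r
  IsInverse-base {P} {Q} {c} {r} P≈Q H = record
    { head = IsInverse.head H
    ; step = λ n → trans (IsInverse.step H n) (+-congʳ (*-congʳ (^-congˡ (suc n) P≈Q)))
    }

  ^-double : ∀ Q n → Q ^ double n ≈ (Q * Q) ^ n
  ^-double Q zero    = refl
  ^-double Q (suc n) = trans (sym (*-assoc Q Q _)) (*-congˡ (^-double Q n))

  poch-dissect : ∀ x Q n → poch x Q (double n) ≈ poch x (Q * Q) n * poch (x * Q) (Q * Q) n
  poch-dissect x Q zero    = sym (*-identityˡ 1#)
  poch-dissect x Q (suc n) = begin
    (1# - x * (Q * Q ^ double n)) * ((1# - x * Q ^ double n) * poch x Q (double n))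
      ≈⟨ *-cong (+-congˡ (-‿cong (*-congˡ (*-congˡ (^-double Q n)))))
                (*-cong (+-congˡ (-‿cong (*-congˡ (^-double Q n)))) (poch-dissect x Q n)) ⟩
    (1# - x * (Q * u)) * ((1# - x * u) * (poch x (Q * Q) n * poch (x * Q) (Q * Q) n))
      ≈⟨ solve 5 (λ x Q u y z → (con 1ℤ :- x :* (Q :* u)) :* ((con 1ℤ :- x :* u) :* (y :* z)) :=
                    (con 1ℤ :- x :* u) :* y :* ((con 1ℤ :- x :* Q :* u) :* z)) refl x Q u _ _ ⟩
    (1# - x * u) * poch x (Q * Q) n * ((1# - x * Q * u) * poch (x * Q) (Q * Q) n)   ∎
    where
    u : Carrier
    u = (Q * Q) ^ n

  poch-conjugate : ∀ x Q n → poch x Q n * poch (- x) Q n ≈ poch (x * x) (Q * Q) n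
  poch-conjugate x Q zero    = *-identityˡ 1#
  poch-conjugate x Q (suc n) = begin
    (1# - x * u) * poch x Q n * ((1# - - x * u) * poch (- x) Q n)
      ≈⟨ solve 4 (λ x u y z → (con 1ℤ :- x :* u) :* y :* ((con 1ℤ :- :- x :* u) :* z) :=
                    (con 1ℤ :- x :* x :* (u :* u)) :* (y :* z)) refl x u _ _ ⟩
    (1# - x * x * (u * u)) * (poch x Q n * poch (- x) Q n)
      ≈⟨ *-cong (+-congˡ (-‿cong (*-congˡ (sym (^-distrib-* Q Q n))))) (poch-conjugate x Q n) ⟩
    (1# - x * x * (Q * Q) ^ n) * poch (x * x) (Q * Q) n   ∎
    where
    u : Carrier
    u = Q ^ n

  Row : Series → Series → Series → ℕ → Carrier
  Row w c d i = ∑∞ (λ k → w (i ℕ.+ k) * c i * d k)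

  Row-null : ∀ w {c d} → Null c → Null d → Null (Row w c d)
  Row-null w {c} {d} hc hd i =
    ord-∑∞ (λ k → ord-≤ (ℕₚ.m≤n+m k i) (term k)) (λ k → ord-≤ (ℕₚ.m≤m+n i k) (term k))
    where
    term : ∀ k → Ord (i ℕ.+ k) (w (i ℕ.+ k) * c i * d k)
    term k = ord-* (ord-*ˡ (w (i ℕ.+ k)) (hc i)) (hd k)

  ∑∞-⋆-rows : ∀ w {c d G} → Null c → Null d → Row w c d ≋ G → ∑∞ (λ n → w n * (c ⋆ d) n) ≈ ∑∞ G
  ∑∞-⋆-rows w {c} {d} hc hd rows = trans (∑∞-⋆ w c d hc hd) (∑∞-cong (Row-null w hc hd) rows)

  ∑∞-⋆-spread : ∀ w {c v} → Null c → (∀ l → Ord (double l) (v l)) →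
                ∑∞ (λ n → w n * (c ⋆ spread v) n) ≈ ∑∞ (λ i → ∑∞ (λ l → w (i ℕ.+ double l) * c i * v l))
  ∑∞-⋆-spread w {c} {v} hc hv = ∑∞-⋆-rows w hc (ord-spread 0 hv) λ i →
    ∑∞-spread (λ k → w (i ℕ.+ k) * c i) v hv

  -- Each factor peeled off is absorbed into the weight of the remaining sum; the last factor is a
  -- series in t², whence `double l`.
  ∑∞-⋆⋆⋆-spread : ∀ w {c₁ c₂ c₃ v} → Null c₁ → Null c₂ → Null c₃ → (∀ l → Ord (double l) (v l)) →
    ∑∞ (λ n → w n * (c₁ ⋆ (c₂ ⋆ (c₃ ⋆ spread v))) n) ≈
    ∑∞ (λ i → ∑∞ (λ j → ∑∞ (λ k → ∑∞ (λ l → w (i ℕ.+ (j ℕ.+ (k ℕ.+ double l))) * c₁ i * c₂ j * c₃ k * v l))))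
  ∑∞-⋆⋆⋆-spread w {c₁} {c₂} {c₃} {v} h₁ h₂ h₃ hv =
    ∑∞-⋆-rows w h₁ (Null-⋆ h₂ (Null-⋆ h₃ hs)) λ i →
      ∑∞-⋆-rows (λ k → w (i ℕ.+ k) * c₁ i) h₂ (Null-⋆ h₃ hs) λ j →
        ∑∞-⋆-spread (λ k → w (i ℕ.+ (j ℕ.+ k)) * c₁ i * c₂ j) h₃ hv
    where
    hs : Null (spread v)
    hs = ord-spread 0 hv

  -- Origin of the two double sums in the second identity: 1 contributes the weight at n, and b t
  -- the weight at n + 1.
  ∑∞-weighted-ℓ : ∀ (w : Series) b {D} → Null D → Ord 1 b →
                  ∑∞ (λ n → w n * (ℓ b ⋆ D) n) ≈ ∑∞ (λ n → w n * D n) + ∑∞ (λ n → w (suc n) * b * D n)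
  ∑∞-weighted-ℓ w b {D} hD hb = begin
    ∑∞ (λ n → w n * (ℓ b ⋆ D) n)
      ≈⟨ ∑∞-suc (Null-*ˡ w (ℓ b ⋆ D) ℓD-null) ⟩
    w 0 * (ℓ b ⋆ D) 0 + ∑∞ (λ n → w (suc n) * (ℓ b ⋆ D) (suc n))
      ≈⟨ +-cong (*-congˡ (ℓ⋆-0 b D)) (∑∞-cong (Null-*ˡ (w ∘ suc) ((ℓ b ⋆ D) ∘ suc) (Null-suc ℓD-null)) λ n →
           trans (*-congˡ (ℓ⋆-suc b D n)) (solve 4 (λ w x b y → w :* (x :+ b :* y) := w :* x :+ w :* b :* y) refl _ _ b _)) ⟩
    w 0 * D 0 + ∑∞ (λ n → w (suc n) * D (suc n) + w (suc n) * b * D n)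
      ≈⟨ +-congˡ (∑∞-+ (Null-*ˡ (w ∘ suc) (D ∘ suc) (Null-suc hD)) (Null-*ˡ (λ n → w (suc n) * b) D hD)) ⟩
    w 0 * D 0 + (∑∞ (λ n → w (suc n) * D (suc n)) + ∑∞ (λ n → w (suc n) * b * D n))
      ≈⟨ +-assoc _ _ _ ⟨
    w 0 * D 0 + ∑∞ (λ n → w (suc n) * D (suc n)) + ∑∞ (λ n → w (suc n) * b * D n)
      ≈⟨ +-congʳ (∑∞-suc (Null-*ˡ w D hD)) ⟨
    ∑∞ (λ n → w n * D n) + ∑∞ (λ n → w (suc n) * b * D n)   ∎
    where
    ℓD-null : Null (ℓ b ⋆ D)
    ℓD-null zero    = ord-all _
    ℓD-null (suc n) = ord-≈ (sym (ℓ⋆-suc b D n)) (ord-+ (hD (suc n)) (ord-* hb (hD n)))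

  -- Infinite product identities.

  module InfiniteProducts (poch∞ : Carrier → Carrier → Carrier)
                          (poch∞-lim : ∀ x {Q} → Ord 1 Q → Lim (poch x Q) (poch∞ x Q)) where

    poch∞-dissect : ∀ {x y Q Q²} → Ord 1 Q → x * Q ≈ y → Q * Q ≈ Q² →
                    poch∞ x Q ≈ poch∞ x Q² * poch∞ y Q²
    poch∞-dissect {x} {y} {Q} hQ xQ QQ =
      Lim-≈ (Lim-double (poch∞-lim x hQ)) (Lim-* (poch∞-lim x hQ²) (poch∞-lim y hQ²)) λ n →
      trans (poch-dissect x Q n) (*-cong (poch-cong refl QQ n) (poch-cong xQ QQ n))
      where
      hQ² = ord-≈ QQ (ord-*ˡ Q hQ)

    poch∞-conjugate : ∀ {x y Q Q²} → Ord 1 Q → x * x ≈ y → Q * Q ≈ Q² →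
                      poch∞ x Q * poch∞ (- x) Q ≈ poch∞ y Q²
    poch∞-conjugate {x} {y} {Q} hQ xx QQ =
      Lim-≈ (Lim-* (poch∞-lim x hQ) (poch∞-lim (- x) hQ)) (poch∞-lim y (ord-≈ QQ (ord-*ˡ Q hQ))) λ n →
      trans (poch-conjugate x Q n) (poch-cong xx QQ n)

    -- With a = q², b = q⁴, p = q³: Euler's odd-distinct argument, modulo 12.
    capparelli-reciprocal : ∀ {a b p Q Q² x y} → Ord 1 a → Ord 1 b → Ord 1 p →
      a * a ≈ b → a * b ≈ Q → p * p ≈ Q → Q * Q ≈ Q² → p * Q ≈ x → b * Q ≈ y →
      poch∞ (- p) p * (poch∞ (- a) Q * poch∞ (- b) Q) *
        (poch∞ a Q² * (poch∞ p Q² * (poch∞ x Q² * (poch∞ y Q² * 1#)))) ≈ 1#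
    capparelli-reciprocal {a} {b} {p} {Q} {Q²} {x} {y} ha hb hp aa ab pp QQ pQ bQ = begin
      P * (A * B) * (va * (vp * (vx * (vy * 1#))))
        ≈⟨ solve 7 (λ P A B a p x y → P :* (A :* B) :* (a :* (p :* (x :* (y :* con 1ℤ)))) :=
              (p :* x :* P) :* (a :* A :* (y :* B)))
             refl P A B va vp vx vy ⟩
      (vp * vx * P) * (va * A * (vy * B))   ≈⟨ *-cong odd even ⟩
      1# * 1#                               ≈⟨ *-identityˡ 1# ⟩
      1#                                    ∎
      where
      P = poch∞ (- p) p
      A = poch∞ (- a) Q
      B = poch∞ (- b) Q
      va = poch∞ a Q²
      vp = poch∞ p Q²
      vx = poch∞ x Q²
      vy = poch∞ y Q²
      n₄ = poch∞ b Q²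
      n₈ = poch∞ (b * b) Q²
      hQ : Ord 1 Q
      hQ = ord-≈ pp (ord-*ˡ p hp)
      hQ² : Ord 1 Q²
      hQ² = ord-≈ QQ (ord-*ˡ Q hQ)
      aQ : a * Q ≈ b * b
      aQ = trans (*-congˡ (sym ab)) (trans (sym (*-assoc a a b)) (*-congʳ aa))
      -- The two factors on the left form (p; Q)∞. Times (Q; Q)∞ this is (p; p)∞, and multiplying by
      -- (-p; p)∞ returns (Q; Q)∞, which is cancelled.
      odd : vp * vx * P ≈ 1#
      odd = cancel-~1 (poch-~1 hQ (poch∞-lim Q hQ)) (begin
        poch∞ Q Q * (vp * vx * P)            ≈⟨ *-congˡ (*-congʳ (poch∞-dissect hQ pQ QQ)) ⟨
        poch∞ Q Q * (poch∞ p Q * P)          ≈⟨ solve 3 (λ n m P → n :* (m :* P) := m :* n :* P) refl _ _ _ ⟩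
        poch∞ p Q * poch∞ Q Q * P            ≈⟨ *-congʳ (poch∞-dissect hp pp pp) ⟨
        poch∞ p p * P                        ≈⟨ poch∞-conjugate hp pp pp ⟩
        poch∞ Q Q                            ≈⟨ *-identityʳ _ ⟨
        poch∞ Q Q * 1#                       ∎)
      -- `n₈` completes (a; Q²)∞ to (a; Q)∞ and `n₄` completes (y; Q²)∞ to (b; Q)∞. Conjugation with
      -- A then gives `n₄` and with B gives `n₈`, so both multipliers cancel.
      even : va * A * (vy * B) ≈ 1#
      even =
        cancel-~1 (poch-~1 hb (poch∞-lim b hQ²)) (cancel-~1 (poch-~1 (ord-*ˡ b hb) (poch∞-lim (b * b) hQ²)) (begin
        n₈ * (n₄ * (va * A * (vy * B)))
          ≈⟨ solve 6 (λ n₈ n₄ a A y B → n₈ :* (n₄ :* (a :* A :* (y :* B))) :=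
                (a :* n₈ :* A) :* (n₄ :* y :* B)) refl n₈ n₄ va A vy B ⟩
        (va * n₈ * A) * (n₄ * vy * B)
          ≈⟨ *-cong (*-congʳ (poch∞-dissect hQ aQ QQ)) (*-congʳ (poch∞-dissect hQ bQ QQ)) ⟨
        (poch∞ a Q * A) * (poch∞ b Q * B)
          ≈⟨ *-cong (poch∞-conjugate hQ aa QQ) (poch∞-conjugate hQ refl QQ) ⟩
        n₄ * n₈     ≈⟨ solve 2 (λ x y → x :* y := y :* (x :* con 1ℤ)) refl n₄ n₈ ⟩
        n₈ * (n₄ * 1#)   ∎))

  -- Evaluation of the weighted sum of the coefficients of C.

  module _ {p a b : Carrier} (h2p : Ord 2 p) (ha : Ord 1 a) (hb : Ord 1 b) (ab : a * b ≈ p * p)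
           {w : Series} (w0 : w 0 ≈ 1#) (w-suc : ∀ n → w (suc n) ≈ p ^ n * w n)
           {r α β v α² β² : Series} (r-inv : IsInverse p p r) (v-inv : IsInverse (p * p) p v)
           (α-eu : IsEuler p a α) (β-eu : IsEuler p b β)
           (α²-eu : IsEuler (p * p) a α²) (β²-eu : IsEuler (p * p) b β²) where
    private
      module r = IsInverse r-inv
      module v = IsInverse v-inv
      module α = IsEuler α-eu
      module β = IsEuler β-eu
      module α² = IsEuler α²-eu
      module β² = IsEuler β²-eu

      hp : Ord 1 p
      hp = ord-≤ (s≤s z≤n) h2p

      hpp : Ord 1 (p * p)
      hpp = ord-*ˡ p hp

      e g : Series
      e = α ⋆ (β ⋆ spread v)
      g = α² ⋆ β²

      z : Series
      z = poch (- p) p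

      e-equation : spread (ℓ (- p)) ⋆ e ≋ (ℓ a ⋆ ℓ b) ⋆ σ p e
      e-equation = T.trans
        (product-equation {spread (ℓ (- p))} {ℓ a} {ℓ b} {α} {σ p α} {β} {σ p β} {spread v} {σ p (spread v)}
          α.functional β.functional (spread-inverse v-inv))
        (⋆-cong {ℓ a ⋆ ℓ b} (λ _ → refl) λ n → sym (trans (σ-⋆ p α (β ⋆ spread v) n)
          (⋆-cong {σ p α} (λ _ → refl) (σ-⋆ p β (spread v)) n)))

      g-equation : g ≋ (ℓ a ⋆ ℓ b) ⋆ σ (p * p) g
      g-equation = T.trans (⋆-cong α².functional β².functional)
        (T.trans (interchange (ℓ a) (σ (p * p) α²) (ℓ b) (σ (p * p) β²))
          (⋆-cong {ℓ a ⋆ ℓ b} (λ _ → refl) λ n → sym (σ-⋆ (p * p) α² β² n)))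
        where
        module S = IntegerCoefficients seriesRing
        interchange : ∀ x y z t → (x ⋆ y) ⋆ (z ⋆ t) ≋ (x ⋆ z) ⋆ (y ⋆ t)
        interchange =
          S.solve 4 (λ x y z t → (x S.:* y) S.:* (z S.:* t) S.:= (x S.:* z) S.:* (y S.:* t)) λ _ → refl

      e-0 : e 0 ≈ 1#
      e-0 =
        trans (⋆-0 α (β ⋆ spread v)) (trans (*-cong α.head (trans (⋆-0 β (spread v)) (*-cong β.head v.head)))
        (solve 0 (con 1ℤ :* (con 1ℤ :* con 1ℤ) := con 1ℤ) refl))

      g-0 : g 0 ≈ 1#
      g-0 = trans (⋆-0 α² β²) (trans (*-cong α².head β².head) (*-identityˡ 1#))

      e-1 : (1# - p) * e 1 ≈ a + b
      e-1 = begin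
        (1# - p) * e 1     ≈⟨ solve 2 (λ p x → (con 1ℤ :- p) :* x := x :- p :* con 1ℤ :* x) refl p (e 1) ⟩
        e 1 - σ p e 1
          ≈⟨ +-congʳ (trans (sym (spread-ℓ⋆-1 (- p) e)) (trans (e-equation 1) (ℓℓ⋆-1 a b (σ p e)))) ⟩
        σ p e 1 + (a + b) * (1# * e 0) - σ p e 1
          ≈⟨ +-congʳ (+-congˡ (*-congˡ (*-congˡ e-0))) ⟩
        σ p e 1 + (a + b) * (1# * 1#) - σ p e 1
          ≈⟨ solve 2 (λ s x → x :+ s :* (con 1ℤ :* con 1ℤ) :- x := s) refl (a + b) (σ p e 1) ⟩
        a + b              ∎

      g-1 : (1# - p * p) * g 1 ≈ a + b
      g-1 = begin
        (1# - p * p) * g 1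
          ≈⟨ solve 2 (λ p x → (con 1ℤ :- p :* p) :* x := x :- p :* p :* con 1ℤ :* x) refl p (g 1) ⟩
        g 1 - σ (p * p) g 1    ≈⟨ +-congʳ (trans (g-equation 1) (ℓℓ⋆-1 a b (σ (p * p) g))) ⟩
        σ (p * p) g 1 + (a + b) * (1# * g 0) - σ (p * p) g 1
          ≈⟨ +-congʳ (+-congˡ (*-congˡ (*-congˡ g-0))) ⟩
        σ (p * p) g 1 + (a + b) * (1# * 1#) - σ (p * p) g 1
          ≈⟨ solve 2 (λ s x → x :+ s :* (con 1ℤ :* con 1ℤ) :- x := s) refl (a + b) (σ (p * p) g 1) ⟩
        a + b              ∎

      -- Because a b = p², the last coefficient is p (1 + p^(n+1)), and 1 + p^(n+1) is the ratio of
      -- z (n + 1) to z n.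
      e-2+ : ∀ n → (1# - p ^ (2 ℕ.+ n)) * e (2 ℕ.+ n) ≈ (a + b) * (p ^ (1 ℕ.+ n) * e (1 ℕ.+ n)) + (p + p * p * p ^ n) * e n
      e-2+ n = begin
        (1# - p ^ (2 ℕ.+ n)) * e (2 ℕ.+ n)
          ≈⟨ solve 4 (λ p x y U → (con 1ℤ :- U) :* x := (x :+ :- p :* y) :+ (p :* y :- U :* x)) refl p _ (e n) _ ⟩
        (e (2 ℕ.+ n) + (- p) * e n) + (p * e n - σ p e (2 ℕ.+ n))
          ≈⟨ +-congʳ (trans (sym (spread-ℓ⋆-2+ (- p) e n)) (trans (e-equation (2 ℕ.+ n)) (ℓℓ⋆-2+ a b (σ p e) n))) ⟩
        (σ p e (2 ℕ.+ n) + (a + b) * σ p e (1 ℕ.+ n) + a * b * σ p e n) + (p * e n - σ p e (2 ℕ.+ n))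
          ≈⟨ +-congʳ (+-congˡ (*-congʳ ab)) ⟩
        (σ p e (2 ℕ.+ n) + (a + b) * σ p e (1 ℕ.+ n) + p * p * σ p e n) + (p * e n - σ p e (2 ℕ.+ n))
          ≈⟨ solve 5 (λ X Y p u x → (X :+ Y :+ p :* p :* (u :* x)) :+ (p :* x :- X) :=
                Y :+ (p :+ p :* p :* u) :* x) refl _ _ p (p ^ n) (e n) ⟩
        (a + b) * (p ^ (1 ℕ.+ n) * e (1 ℕ.+ n)) + (p + p * p * p ^ n) * e n   ∎

      g-2+ : ∀ n → (1# - p ^ (2 ℕ.+ n) * p ^ (2 ℕ.+ n)) * g (2 ℕ.+ n) ≈
                   (a + b) * (p ^ (1 ℕ.+ n) * p ^ (1 ℕ.+ n) * g (1 ℕ.+ n)) + p * p * (p ^ n * p ^ n * g n)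
      g-2+ n = begin
        (1# - p ^ (2 ℕ.+ n) * p ^ (2 ℕ.+ n)) * g (2 ℕ.+ n)
          ≈⟨ solve 2 (λ x U → (con 1ℤ :- U) :* x := x :- U :* x) refl _ _ ⟩
        g (2 ℕ.+ n) - p ^ (2 ℕ.+ n) * p ^ (2 ℕ.+ n) * g (2 ℕ.+ n)
          ≈⟨ +-cong (trans (g-equation (2 ℕ.+ n)) (ℓℓ⋆-2+ a b (σ (p * p) g) n)) (-‿cong (square (2 ℕ.+ n))) ⟩
        (σ (p * p) g (2 ℕ.+ n) + (a + b) * σ (p * p) g (1 ℕ.+ n) + a * b * σ (p * p) g n) - σ (p * p) g (2 ℕ.+ n)
          ≈⟨ solve 3 (λ X Y Z → (X :+ Y :+ Z) :- X := Y :+ Z) refl _ _ _ ⟩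
        (a + b) * σ (p * p) g (1 ℕ.+ n) + a * b * σ (p * p) g n
          ≈⟨ +-cong (*-congˡ (sym (square (1 ℕ.+ n)))) (*-cong ab (sym (square n))) ⟩
        (a + b) * (p ^ (1 ℕ.+ n) * p ^ (1 ℕ.+ n) * g (1 ℕ.+ n)) + p * p * (p ^ n * p ^ n * g n)   ∎
        where
        square : ∀ n → p ^ n * p ^ n * g n ≈ σ (p * p) g n
        square n = *-congʳ (sym (^-distrib-* p p n))

      -- Multiplied by 1 - p^(2n) and by w or z, the recurrences of e and g become the same one.
      we≈zg : ∀ n → w n * e n ≈ z n * g n
      we≈zg zero       = *-cong w0 (trans e-0 (sym g-0))
      we≈zg (suc zero) = cancel-1- hp (begin
        (1# - p) * (w 1 * e 1)         ≈⟨ *-congˡ (*-congʳ (trans (w-suc 0) (*-congˡ w0))) ⟩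
        (1# - p) * (1# * 1# * e 1)
          ≈⟨ solve 2 (λ p x → (con 1ℤ :- p) :* (con 1ℤ :* con 1ℤ :* x) := (con 1ℤ :- p) :* x) refl p (e 1) ⟩
        (1# - p) * e 1                 ≈⟨ trans e-1 (sym g-1) ⟩
        (1# - p * p) * g 1
          ≈⟨ solve 2 (λ p x → (con 1ℤ :- p :* p) :* x :=
                (con 1ℤ :- p) :* ((con 1ℤ :- (:- p) :* con 1ℤ) :* con 1ℤ :* x)) refl p (g 1) ⟩
        (1# - p) * (z 1 * g 1)         ∎)
      we≈zg (suc (suc n)) = cancel-1- (ord-*ˡ U (ord-^-suc hp (suc n))) (begin
        (1# - U * U) * (w (2 ℕ.+ n) * e (2 ℕ.+ n))
          ≈⟨ *-congˡ (*-congʳ (trans (w-suc (suc n)) (*-congˡ (w-suc n)))) ⟩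
        (1# - U * U) * (p * u * (u * w n) * e (2 ℕ.+ n))
          -- Of 1 - U² = (1 + U)(1 - U), the second factor feeds the recurrence of e and the first
          -- later takes z (n + 1) to z (n + 2).
          ≈⟨ solve 5 (λ U p u w x → (con 1ℤ :- U :* U) :* (p :* u :* (u :* w) :* x) :=
                       (con 1ℤ :+ U) :* (p :* u :* (u :* w) :* ((con 1ℤ :- U) :* x))) refl U p u (w n) (e (2 ℕ.+ n)) ⟩
        (1# + U) * (p * u * (u * w n) * ((1# - U) * e (2 ℕ.+ n)))
          ≈⟨ *-congˡ (*-congˡ (e-2+ n)) ⟩
        (1# + U) * (p * u * (u * w n) * ((a + b) * (p * u * e (1 ℕ.+ n)) + (p + p * p * u) * e n))
          ≈⟨ solve 7 (λ U p u w s x y → (con 1ℤ :+ U) :* (p :* u :* (u :* w) :* (s :* (p :* u :* x) :+ (p :+ p :* p :* u) :* y)) :=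
                        (con 1ℤ :+ U) :* (p :* u :* (p :* u) :* s :* (u :* w :* x) :+ p :* u :* (p :* u) :* (con 1ℤ :+ p :* u) :* (w :* y)))
               refl U p u (w n) (a + b) (e (1 ℕ.+ n)) (e n) ⟩
        (1# + U) * (p * u * (p * u) * (a + b) * (u * w n * e (1 ℕ.+ n)) + p * u * (p * u) * (1# + p * u) * (w n * e n))
          ≈⟨ *-congˡ (+-cong (*-congˡ (trans (*-congʳ (sym (w-suc n))) (we≈zg (suc n)))) (*-congˡ (we≈zg n))) ⟩
        (1# + U) * (p * u * (p * u) * (a + b) * (z (1 ℕ.+ n) * g (1 ℕ.+ n)) + p * u * (p * u) * (1# + p * u) * (z n * g n))
          -- In the last term 1 + p u raises z n to z (n + 1), so z (n + 1) becomes a common factor.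
          ≈⟨ solve 7 (λ U p u s z x y →
                 (con 1ℤ :+ U) :* (p :* u :* (p :* u) :* s :* ((con 1ℤ :- :- p :* u) :* z :* x) :+ p :* u :* (p :* u) :* (con 1ℤ :+ p :* u) :* (z :* y)) :=
                 (con 1ℤ :+ U) :* ((con 1ℤ :- :- p :* u) :* z) :* (s :* (p :* u :* (p :* u) :* x) :+ p :* p :* (u :* u :* y)))
               refl U p u (a + b) (z n) (g (1 ℕ.+ n)) (g n) ⟩
        (1# + U) * z (1 ℕ.+ n) * ((a + b) * (p * u * (p * u) * g (1 ℕ.+ n)) + p * p * (u * u * g n))
          ≈⟨ *-congˡ (g-2+ n) ⟨
        (1# + U) * z (1 ℕ.+ n) * ((1# - U * U) * g (2 ℕ.+ n))
          ≈⟨ solve 5 (λ p u z V x → (con 1ℤ :+ p :* (p :* u)) :* z :* (V :* x) :=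
                V :* ((con 1ℤ :- :- p :* (p :* u)) :* z :* x))
               refl p u (z (1 ℕ.+ n)) (1# - U * U) (g (2 ℕ.+ n)) ⟩
        (1# - U * U) * (z (2 ℕ.+ n) * g (2 ℕ.+ n))   ∎)
        where
        u U : Carrier
        u = p ^ n
        U = p ^ (2 ℕ.+ n)

      w-+ : ∀ m i → w (m ℕ.+ i) ≈ w m * ((p ^ m) ^ i * w i)
      w-+ m zero    = trans (reflexive (≡.cong w (ℕₚ.+-identityʳ m)))
        (sym (trans (*-congˡ (trans (*-identityˡ _) w0)) (*-identityʳ _)))
      w-+ m (suc i) = begin
        w (m ℕ.+ suc i)                              ≡⟨ ≡.cong w (ℕₚ.+-suc m i) ⟩
        w (suc (m ℕ.+ i))                            ≈⟨ w-suc (m ℕ.+ i) ⟩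
        p ^ (m ℕ.+ i) * w (m ℕ.+ i)                  ≈⟨ *-cong (^-homo-* p m i) (w-+ m i) ⟩
        p ^ m * p ^ i * (w m * ((p ^ m) ^ i * w i))
          ≈⟨ solve 5 (λ x y w z v → x :* y :* (w :* (z :* v)) := w :* (x :* z :* (y :* v))) refl _ _ _ _ _ ⟩
        w m * (p ^ m * (p ^ m) ^ i * (p ^ i * w i))  ≈⟨ *-congˡ (*-congˡ (w-suc i)) ⟨
        w m * (p ^ m * (p ^ m) ^ i * w (suc i))      ∎

      wr : Series
      wr i = w i * r i

      -- Euler's two expansions differ exactly by the factor p^(n(n-1)/2), so weighting turns the
      -- coefficients of 1/(p t; p)∞ into those of (-p t; p)∞.
      wr-euler : IsEuler p p wr
      wr-euler = record
        { head = trans (*-cong w0 r.head) (*-identityˡ 1#)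
        ; step = λ n → begin
            w (suc n) * r (suc n)
              ≈⟨ *-congˡ (r.step n) ⟩
            w (suc n) * (p ^ suc n * r (suc n) + p * r n)
              ≈⟨ solve 5 (λ w U x p y → w :* (U :* x :+ p :* y) :=
                    U :* (w :* x) :+ p :* (w :* y)) refl _ _ _ p (r n) ⟩
            p ^ suc n * wr (suc n) + p * (w (suc n) * r n)
              ≈⟨ +-congˡ (*-congˡ (trans (*-congʳ (w-suc n)) (*-assoc _ _ _))) ⟩
            p ^ suc n * wr (suc n) + p * (p ^ n * wr n)   ∎
        }

      module W = Euler hp hp wr-euler

      e-null : Null e
      e-null = Null-⋆ (α.null hp ha) (Null-⋆ (β.null hp hb) (ord-spread 0 (v.double-null hpp h2p)))

    capparelli-sum : ∀ {P A B} → Lim (poch (- p) p) P → Lim (poch (- a) (p * p)) A → Lim (poch (- b) (p * p)) B →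
                     ∑∞ (λ n → w n * (r ⋆ e) n) ≈ P * (A * B)
    capparelli-sum {P} {A} {B} hP hA hB = begin
      ∑∞ (λ n → w n * (r ⋆ e) n)
        -- The factors are swapped so that the inner sum runs over the index of r, the one that
        -- Euler's expansion evaluates.
        ≈⟨ ∑∞-cong (Null-*ˡ w (r ⋆ e) (Null-⋆ r-null e-null)) (λ n → *-congˡ (⋆-comm r e n)) ⟩
      ∑∞ (λ n → w n * (e ⋆ r) n)
        ≈⟨ ∑∞-⋆ w e r e-null r-null ⟩
      ∑∞ (λ m → ∑∞ (λ i → w (m ℕ.+ i) * e m * r i))
        ≈⟨ ∑∞-cong rows-null rows ⟩
      ∑∞ (λ m → W.tail 0 * g m)
        ≈⟨ ∑∞-* (W.tail 0) g-null ⟩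
      W.tail 0 * ∑∞ g
        ≈⟨ *-cong tail≈P ∑g≈ ⟩
      P * (A * B)   ∎
      where
      r-null : Null r
      r-null = r.null hp hp
      g-null : Null g
      g-null = Null-⋆ (α².null hpp ha) (β².null hpp hb)
      term : ∀ m i → w (m ℕ.+ i) * e m * r i ≈ w m * e m * σ (p ^ m) wr i
      term m i = trans (*-congʳ (*-congʳ (w-+ m i)))
        (solve 5 (λ w x y e r → w :* (x :* y) :* e :* r := w :* e :* (x :* (y :* r))) refl _ _ _ _ _)
      term-ord : ∀ m i → Ord (m ℕ.+ i) (w (m ℕ.+ i) * e m * r i)
      term-ord m i = ord-* (ord-*ˡ _ (e-null m)) (r-null i)
      row-null : ∀ m → Null (λ i → w (m ℕ.+ i) * e m * r i)
      row-null m i = ord-≤ (ℕₚ.m≤n+m i m) (term-ord m i)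
      rows-null : Null (λ m → ∑∞ (λ i → w (m ℕ.+ i) * e m * r i))
      rows-null m = ord-∑∞ (row-null m) λ i → ord-≤ (ℕₚ.m≤m+n m i) (term-ord m i)
      rows : (λ m → ∑∞ (λ i → w (m ℕ.+ i) * e m * r i)) ≋ (λ m → W.tail 0 * g m)
      rows m = begin
        ∑∞ (λ i → w (m ℕ.+ i) * e m * r i)       ≈⟨ ∑∞-cong (row-null m) (term m) ⟩
        ∑∞ (λ i → w m * e m * σ (p ^ m) wr i)    ≈⟨ ∑∞-* (w m * e m) (W.tail-null m) ⟩
        w m * e m * W.tail m                     ≈⟨ *-congʳ (we≈zg m) ⟩
        z m * g m * W.tail m                     ≈⟨ solve 3 (λ z g t → z :* g :* t := z :* t :* g) refl _ _ _ ⟩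
        z m * W.tail m * g m                     ≈⟨ *-congʳ (W.poch-tail m) ⟩
        W.tail 0 * g m                           ∎
      tail≈P : W.tail 0 ≈ P
      tail≈P = trans (sym W.sum≈tail) (Lim-≈ W.sum-poch hP λ _ → refl)
      ∑g≈ : ∑∞ g ≈ A * B
      ∑g≈ = begin
        ∑∞ g                                     ≈⟨ ∑∞-cong g-null (λ n → sym (*-identityˡ _)) ⟩
        -- With constant weight 1, `∑∞-⋆` says that evaluation at t = 1 is multiplicative.
        ∑∞ (λ n → 1# * g n)                      ≈⟨ ∑∞-⋆ (λ _ → 1#) α² β² (α².null hpp ha) (β².null hpp hb) ⟩
        ∑∞ (λ i → ∑∞ (λ k → 1# * α² i * β² k))   ≈⟨ ∑∞-cong ∑-null ∑-rows ⟩
        ∑∞ (λ i → ∑∞ β² * α² i)                  ≈⟨ ∑∞-* (∑∞ β²) (α².null hpp ha) ⟩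
        ∑∞ β² * ∑∞ α²                            ≈⟨ *-comm _ _ ⟩
        ∑∞ α² * ∑∞ β²
          ≈⟨ *-cong (Lim-≈ (Euler.sum-poch hpp ha α²-eu) hA λ _ → refl) (Lim-≈ (Euler.sum-poch hpp hb β²-eu) hB λ _ → refl) ⟩
        A * B                                    ∎
        where
        ∑-rows : (λ i → ∑∞ (λ k → 1# * α² i * β² k)) ≋ (λ i → ∑∞ β² * α² i)
        ∑-rows i =
          trans (∑∞-* (1# * α² i) (β².null hpp hb)) (solve 2 (λ x y → con 1ℤ :* x :* y := y :* x) refl _ _)
        ∑-null : Null (λ i → ∑∞ (λ k → 1# * α² i * β² k))
        ∑-null i = ord-≈ (sym (∑-rows i)) (ord-*ˡ _ (α².null hpp ha i))

    -- The double sums through uniqueness of solutions in t.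

    private
      A₁ A₂ : Series
      A₁ = spread (ℓ (- p))
      A₂ = spread (ℓ (- (p * p)))

      quotient-functional : (A₁ ⋆ A₂) ⋆ (r ⋆ e) ≋ ((ℓ a ⋆ ℓ b) ⋆ ℓ p) ⋆ σ p (r ⋆ e)
      quotient-functional = T.trans
        (quotient-equation {ℓ p} {ℓ (- p)} {A₁} {A₂} {ℓ a ⋆ ℓ b} {r} {σ p r} {e} {σ p e}
          (ℓ-conjugate p) r.functional e-equation)
        (⋆-cong {(ℓ a ⋆ ℓ b) ⋆ ℓ p} (λ _ → refl) λ n → sym (σ-⋆ p r e n))

      spread-r-1 : A₁ ⋆ spread r ≋ spread (σ p r)
      spread-r-1 n = trans (sym (spread-⋆ (ℓ (- p)) r n)) (spread-cong r.functional n)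

      spread-r-2 : A₂ ⋆ spread (σ p r) ≋ σ p (spread r)
      spread-r-2 n = begin
        (A₂ ⋆ spread (σ p r)) n                    ≈⟨ spread-⋆ (ℓ (- (p * p))) (σ p r) n ⟨
        spread (ℓ (- (p * p)) ⋆ σ p r) n           ≈⟨ spread-cong shifted n ⟩
        spread (σ (p * p) r) n                     ≈⟨ σ-spread p r n ⟨
        σ p (spread r) n                           ∎
        where
        shifted : ℓ (- (p * p)) ⋆ σ p r ≋ σ (p * p) r
        shifted n = begin
          (ℓ (- (p * p)) ⋆ σ p r) n
            ≈⟨ ⋆-cong {g =
              σ p r} (λ k → trans (ℓ-cong (-‿distribʳ-* p p) k) (sym (σ-ℓ p (- p) k))) (λ _ → refl) n ⟩
          (σ p (ℓ (- p)) ⋆ σ p r) n                ≈⟨ σ-⋆ p (ℓ (- p)) r n ⟨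
          σ p (ℓ (- p) ⋆ r) n                      ≈⟨ σ-cong p r.functional n ⟩
          σ p (σ p r) n                            ≈⟨ σ-σ p p r n ⟩
          σ (p * p) r n                            ∎

      -- The first-order equation in q is used at t, q t and q² t; the three shifts compose to t ↦ p
      -- t because p = q³.
      triple : ∀ {q c u B₁ B₂ B₃} → p ≈ q * (q * q) → IsEuler q c u → c ≈ B₁ → q * c ≈ B₂ → q * (q * c) ≈ B₃ →
               u ≋ ℓ B₁ ⋆ (ℓ B₂ ⋆ (ℓ B₃ ⋆ σ p u))
      triple {q} {c} {u} {B₁} {B₂} {B₃} p≈ u-eu h₁ h₂ h₃ =
        T.trans step₁ (⋆-cong (ℓ-cong h₁) (T.trans step₂ (⋆-cong (ℓ-cong h₂) (T.trans step₃ (⋆-cong (ℓ-cong h₃) cube)))))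
        where
        shift : ∀ {c f g} → g ≋ ℓ c ⋆ f → σ q g ≋ ℓ (q * c) ⋆ σ q f
        shift {c} {f} h n =
          trans (σ-cong q h n) (trans (σ-⋆ q (ℓ c) f n) (⋆-cong {g = σ q f} (σ-ℓ q c) (λ _ → refl) n))
        step₁ : u ≋ ℓ c ⋆ σ q u
        step₁ = IsEuler.functional u-eu
        step₂ : σ q u ≋ ℓ (q * c) ⋆ σ q (σ q u)
        step₂ = shift {c} {σ q u} step₁
        step₃ : σ q (σ q u) ≋ ℓ (q * (q * c)) ⋆ σ q (σ q (σ q u))
        step₃ = shift {q * c} {σ q (σ q u)} step₂
        cube : σ q (σ q (σ q u)) ≋ σ p u
        cube n = trans (σ-cong q (σ-σ q q u) n) (trans (σ-σ q (q * q) u n) (σ-base (sym p≈) u n))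

      r⋆e-unique : ∀ D → (A₁ ⋆ A₂) ⋆ D ≋ ((ℓ a ⋆ ℓ b) ⋆ ℓ p) ⋆ σ p D → D 0 ≈ 1# → D ≋ r ⋆ e
      r⋆e-unique D hD D0 = σ-unique p (A₁ ⋆ A₂) ((ℓ a ⋆ ℓ b) ⋆ ℓ p) D (r ⋆ e)
        (trans (⋆-0 A₁ A₂) (*-identityˡ 1#))
        (trans (⋆-0 (ℓ a ⋆ ℓ b) (ℓ p)) (trans (*-congʳ (⋆-0 (ℓ a) (ℓ b))) (solve 0 (con 1ℤ :* con 1ℤ :* con 1ℤ := con 1ℤ) refl)))
        (λ n x y → cancel-1- (ord-^-suc hp n)) hD quotient-functional
        (trans D0 (sym (trans (⋆-0 r e) (trans (*-cong r.head e-0) (*-identityˡ 1#)))))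

    module _ {q c : Carrier} {u : Series} (hq : Ord 1 q) (hc : Ord 1 c) (p≈ : p ≈ q * (q * q)) (u-eu : IsEuler q c u) where
      private
        D : Series
        D = u ⋆ spread r

        D-0 : D 0 ≈ 1#
        D-0 = trans (⋆-0 u (spread r)) (trans (*-cong (IsEuler.head u-eu) r.head) (*-identityˡ 1#))

        D-functional : ∀ {B₁ B₂ B₃} → c ≈ B₁ → q * c ≈ B₂ → q * (q * c) ≈ B₃ →
                       (A₁ ⋆ A₂) ⋆ D ≋ ((ℓ B₁ ⋆ ℓ B₃) ⋆ ℓ B₂) ⋆ σ p D
        D-functional {B₁} {B₂} {B₃} h₁ h₂ h₃ = T.trans
          (double-sum-equation {A₁} {A₂} {ℓ B₁} {ℓ B₂} {ℓ B₃} {u} {σ p u} {spread r} {spread (σ p r)} {σ p (spread r)}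
            (triple p≈ u-eu h₁ h₂ h₃) spread-r-1 spread-r-2)
          (⋆-cong {(ℓ B₁ ⋆ ℓ B₃) ⋆ ℓ B₂} (λ _ → refl) λ n → sym (σ-⋆ p u (spread r) n))

      private
        D≋r⋆e : c ≈ a → q * c ≈ p → q * (q * c) ≈ b → D ≋ r ⋆ e
        D≋r⋆e h₁ h₂ h₃ = r⋆e-unique D (D-functional h₁ h₂ h₃) D-0

        -- The three factors of u are here 1 + p t, 1 + p b t and 1 + a t. The middle one is 1 + b t
        -- after t ↦ p t, so multiplying D by 1 + b t exchanges it for the factor that `r ⋆ e`
        -- requires.
        ℓ⋆D≋r⋆e : c ≈ p → q ≈ b → q * (q * c) ≈ a → ℓ b ⋆ D ≋ r ⋆ e
        ℓ⋆D≋r⋆e h₁ h₂ h₃ = r⋆e-unique (ℓ b ⋆ D)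
          (T.trans (extended-equation {A₁ ⋆ A₂} {ℓ b} {ℓ p} {ℓ (p * b)} {ℓ a} {D} {σ p D} (D-functional h₁ qc≈ h₃))
            (⋆-cong {(ℓ a ⋆ ℓ b) ⋆ ℓ p} (λ _ → refl) λ n →
              sym (trans (σ-⋆ p (ℓ b) D n) (⋆-cong {g = σ p D} (σ-ℓ p b) (λ _ → refl) n))))
          (trans (ℓ⋆-0 b D) D-0)
          where
          qc≈ : q * c ≈ p * b
          qc≈ = trans (*-comm q c) (*-cong h₁ h₂)

      module _ {P A B : Carrier} (hP : Lim (poch (- p) p) P) (hA : Lim (poch (- a) (p * p)) A) (hB : Lim (poch (- b) (p * p)) B) where
        private
          u-null : Null u
          u-null = IsEuler.null u-eu hq hc
          r-null : ∀ l → Ord (double l) (r l)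
          r-null = r.double-null hp h2p
          D-null : Null D
          D-null = Null-⋆ u-null (ord-spread 0 r-null)

        double-sum-1 : c ≈ a → q * c ≈ p → q * (q * c) ≈ b →
                       ∑∞ (λ i → ∑∞ (λ j → w (i ℕ.+ double j) * u i * r j)) ≈ P * (A * B)
        double-sum-1 h₁ h₂ h₃ = begin
          ∑∞ (λ i → ∑∞ (λ j → w (i ℕ.+ double j) * u i * r j))   ≈⟨ ∑∞-⋆-spread w u-null r-null ⟨
          ∑∞ (λ n → w n * D n)         ≈⟨ ∑∞-cong (Null-*ˡ w D D-null) (λ n → *-congˡ (D≋r⋆e h₁ h₂ h₃ n)) ⟩
          ∑∞ (λ n → w n * (r ⋆ e) n)   ≈⟨ capparelli-sum hP hA hB ⟩
          P * (A * B)                  ∎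

        double-sum-2 : c ≈ p → q ≈ b → q * (q * c) ≈ a →
                       ∑∞ (λ i → ∑∞ (λ j → w (i ℕ.+ double j) * u i * r j)) +
                       ∑∞ (λ i → ∑∞ (λ j → w (suc (i ℕ.+ double j)) * b * u i * r j)) ≈ P * (A * B)
        double-sum-2 h₁ h₂ h₃ = begin
          ∑∞ (λ i → ∑∞ (λ j → w (i ℕ.+ double j) * u i * r j)) +
          ∑∞ (λ i → ∑∞ (λ j → w (suc (i ℕ.+ double j)) * b * u i * r j))
            ≈⟨ +-cong (∑∞-⋆-spread w u-null r-null) (∑∞-⋆-spread (λ n → w (suc n) * b) u-null r-null) ⟨
          ∑∞ (λ n → w n * D n) + ∑∞ (λ n → w (suc n) * b * D n)   ≈⟨ ∑∞-weighted-ℓ w b D-null hb ⟨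
          ∑∞ (λ n → w n * (ℓ b ⋆ D) n)
            ≈⟨ ∑∞-cong (Null-*ˡ w (r ⋆ e) (Null-⋆ (r.null hp hp) e-null)) (λ n → *-congˡ (sym (ℓ⋆D≋r⋆e h₁ h₂ h₃ n))) ⟨
          ∑∞ (λ n → w n * (r ⋆ e) n)   ≈⟨ capparelli-sum hP hA hB ⟩
          P * (A * B)                  ∎

    quadruple-sum : ∀ {P A B} → Lim (poch (- p) p) P → Lim (poch (- a) (p * p)) A → Lim (poch (- b) (p * p)) B →
      ∑∞ (λ i → ∑∞ (λ j → ∑∞ (λ k → ∑∞ (λ l → w (i ℕ.+ (j ℕ.+ (k ℕ.+ double l))) * r i * α j * β k * v l)))) ≈ P * (A * B)
    quadruple-sum hP hA hB = trans
      (sym (∑∞-⋆⋆⋆-spread w (r.null hp hp) (α.null hp ha) (β.null hp hb) (v.double-null hpp h2p)))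
      (capparelli-sum hP hA hB)

-- Integer power series in q and their q-adic filtration.

open import Data.Nat using (_+_; _*_; _^_)
open import Data.Product using (_×_; proj₁)
open import Defs
open ≡ using (refl; sym; trans; cong; cong₂; subst)

module ℤ[] = PowerSeries ℤₚ.+-*-commutativeRing

-- Over the integers the product `_⋆_` unfolds to `_⊛_` and `one` to `1ₛ`, so the abstract results
-- apply to `PS` without translation.
K : CommutativeRing 0ℓ 0ℓ
K = ℤ[].seriesRing

module K = CommutativeRing K
module K[] = PowerSeries K

∑<-truncate : ∀ {M N} {d : ℕ → ℤ} → M ≤ N → (∀ k → M ≤ k → d k ≡ 0ℤ) → ℤ[].∑< N d ≡ ℤ[].∑< M d
∑<-truncate {N = N} z≤n       h = sum-zero N (λ k _ → h k z≤n)
∑<-truncate {d = d} (s≤s M≤N) h = cong (ℤ._+_ (d 0)) (∑<-truncate M≤N λ k M≤k → h (suc k) (s≤s M≤k))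

∑<-coefficient : ∀ N (c : ℕ → PS) n → K[].∑< N c n ≡ ℤ[].∑< N (λ k → c k n)
∑<-coefficient zero    c n = refl
∑<-coefficient (suc N) c n = cong (ℤ._+_ (c 0 n)) (∑<-coefficient N (c ∘ suc) n)

vanishing : Filtration K
vanishing = record
  { Ord       = Ord
  ; ord-≈     = λ x≈y h m m<n → trans (sym (x≈y m)) (h m m<n)
  ; ord-≤     = λ m≤n h k k<m → h k (ℕₚ.<-≤-trans k<m m≤n)
  ; ord-all   = λ x m ()
  ; ord-0     = λ n m _ → refl
  ; ord-+     = λ hx hy m m<n → cong₂ ℤ._+_ (hx m m<n) (hy m m<n)
  ; ord-neg   = λ hx m m<n → cong ℤ.-_ (hx m m<n)
  ; ord-*     = ord-*
  ; separated = λ h n → h (suc n) n ℕₚ.≤-refl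
  -- In a null family the terms after index n have no coefficient at qⁿ, so the cut is harmless.
  ; ∑∞        = λ c n → ℤ[].∑< (suc n) (λ k → c k n)
  ; ∑∞-tail   = tail
  }
  where
  Ord : ℕ → PS → Set
  Ord n f = ∀ m → m < n → f m ≡ 0ℤ
  ord-* : ∀ {m n f g} → Ord m f → Ord n g → Ord (m + n) (f ⊛ g)
  ord-* {m} {n} {f} {g} hf hg s s<m+n = sum-zero (suc s) term
    where
    term : ∀ k → k < suc s → f k ℤ.* g (s ∸ k) ≡ 0ℤ
    -- As s < m + n, either k < m or s - k < n, so one of the two factors vanishes.
    term k (s≤s k≤s) with ℕₚ.<-≤-connex k m
    ... | inj₁ k<m = cong (ℤ._* g (s ∸ k)) (hf k k<m)
    ... | inj₂ m≤k = trans (cong (f k ℤ.*_) (hg (s ∸ k) s∸k<n)) (ℤₚ.*-zeroʳ (f k))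
      where
      s∸k<n : s ∸ k < n
      s∸k<n = ℕₚ.+-cancelˡ-< k _ _ (subst (_< k + n) (sym (ℕₚ.m+[n∸m]≡n k≤s))
        (ℕₚ.<-≤-trans s<m+n (ℕₚ.+-monoˡ-≤ n m≤k)))
  tail : ∀ {m} B c → (∀ k → Ord k (c k)) → (∀ k → B ≤ k → Ord m (c k)) →
         Ord m (λ n → ℤ[].∑< (suc n) (λ k → c k n) ℤ.- K[].∑< B c n)
  tail B c null high n n<m =
    trans (cong (λ z → ℤ[].∑< (suc n) (λ k → c k n) ℤ.- z) same) (ℤₚ.+-inverseʳ (ℤ[].∑< (suc n) (λ k → c k n)))
    where
    same : K[].∑< B c n ≡ ℤ[].∑< (suc n) (λ k → c k n)
    -- Terms between the two cut-offs vanish at qⁿ: by `high` when B is the smaller, by `null`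
    -- otherwise.
    same with ℕₚ.≤-total B (suc n)
    ... | inj₁ B≤1+n = trans (∑<-coefficient B c n) (sym (∑<-truncate B≤1+n λ k B≤k → high k B≤k n n<m))
    ... | inj₂ 1+n≤B = trans (∑<-coefficient B c n) (∑<-truncate 1+n≤B λ k n<k → null k n n<k)

open Filtration vanishing using (Ord; ord-≤; ∑∞)
open Summation vanishing
open Capparelli vanishing
module KSolver = IntegerCoefficients K
open Exp K.semiring using () renaming (_^_ to _^ₖ_)

sumℤ-++ : ∀ xs ys → sumℤ (xs ++ ys) ≡ sumℤ xs ℤ.+ sumℤ ys
sumℤ-++ []       ys = sym (ℤₚ.+-identityˡ _)
sumℤ-++ (x ∷ xs) ys = trans (cong (ℤ._+_ x) (sumℤ-++ xs ys)) (sym (ℤₚ.+-assoc x (sumℤ xs) (sumℤ ys)))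

sumℤ-cartesianProduct : ∀ {A B : Set} (f : A × B → ℤ) (xs : List A) (ys : List B) →
  sumℤ (map f (cartesianProduct xs ys)) ≡ sumℤ (map (λ x → sumℤ (map (λ y → f (x , y)) ys)) xs)
sumℤ-cartesianProduct f []       ys = refl
sumℤ-cartesianProduct f (x ∷ xs) ys = begin
  sumℤ (map f (map (x ,_) ys ++ cartesianProduct xs ys))
    ≡⟨ cong sumℤ (Listₚ.map-++ f (map (x ,_) ys) _) ⟩
  sumℤ (map f (map (x ,_) ys) ++ map f (cartesianProduct xs ys))
    ≡⟨ sumℤ-++ (map f (map (x ,_) ys)) _ ⟩
  sumℤ (map f (map (x ,_) ys)) ℤ.+ sumℤ (map f (cartesianProduct xs ys))
    ≡⟨ cong₂ ℤ._+_ (cong sumℤ (sym (Listₚ.map-∘ ys))) (sumℤ-cartesianProduct f xs ys) ⟩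
  sumℤ (map (λ y → f (x , y)) ys) ℤ.+ sumℤ (map (λ x → sumℤ (map (λ y → f (x , y)) ys)) xs)   ∎
  where open ≡.≡-Reasoning

sumℤ-range : ∀ n (f : ℕ → ℤ) → sumℤ (map f (range n)) ≡ ℤ[].∑< (suc n) f
sumℤ-range n f = cong sumℤ (Listₚ.map-upTo f (suc n))

sumℤ-range-× : ∀ {B : Set} n (f : ℕ × B → ℤ) (ys : List B) (g : ℕ → ℤ) →
  (∀ i → sumℤ (map (λ y → f (i , y)) ys) ≡ g i) → sumℤ (map f (cartesianProduct (range n) ys)) ≡ ℤ[].∑< (suc n) g
sumℤ-range-× n f ys g h = trans (sumℤ-cartesianProduct f (range n) ys)
  (trans (sumℤ-range n rows) (ℤ[].∑<-cong (suc n) {rows} {g} h))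
  where
  rows : ℕ → ℤ
  rows i = sumℤ (map (λ y → f (i , y)) ys)

sumℤ-range₂ : ∀ n (f : ℕ × ℕ → ℤ) → sumℤ (map f (cartesianProduct (range n) (range n))) ≡
              ℤ[].∑< (suc n) (λ i → ℤ[].∑< (suc n) (λ j → f (i , j)))
sumℤ-range₂ n f =
  sumℤ-range-× n f (range n) (λ i → ℤ[].∑< (suc n) (λ j → f (i , j))) λ i → sumℤ-range n (λ j → f (i , j))

sumℤ-range₄ : ∀ n (f : ℕ × ℕ × ℕ × ℕ → ℤ) →
  sumℤ (map f (cartesianProduct (range n) (cartesianProduct (range n) (cartesianProduct (range n) (range n))))) ≡
  ℤ[].∑< (suc n) (λ i → ℤ[].∑< (suc n) (λ j → ℤ[].∑< (suc n) (λ k → ℤ[].∑< (suc n) (λ l → f (i , j , k , l)))))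
sumℤ-range₄ n f =
  sumℤ-range-× n f (cartesianProduct (range n) (cartesianProduct (range n) (range n)))
    (λ i → ℤ[].∑< (suc n) (λ j → ℤ[].∑< (suc n) (λ k → ℤ[].∑< (suc n) (λ l → f (i , j , k , l))))) λ i →
  sumℤ-range-× n (λ v → f (i , v)) (cartesianProduct (range n) (range n))
    (λ j → ℤ[].∑< (suc n) (λ k → ℤ[].∑< (suc n) (λ l → f (i , j , k , l)))) λ j →
  sumℤ-range₂ n (λ v → f (i , j , v))

pow≗^ : ∀ f n → pow f n ≗ f ^ₖ n
pow≗^ f zero    = λ _ → refl
pow≗^ f (suc n) = K.*-congˡ {f} (pow≗^ f n)

⟨⟩≗poch : ∀ a Q n → ⟨ a ⨾ Q ⟩ n ≗ poch a Q n
⟨⟩≗poch a Q zero    = λ _ → refl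
⟨⟩≗poch a Q (suc n) = K.*-cong {1ₛ ⊖ a ⊛ pow Q n} {1ₛ ⊖ a ⊛ (Q ^ₖ n)} {⟨ a ⨾ Q ⟩ n} {poch a Q n}
  (K.+-congˡ {1ₛ} (K.-‿cong {a ⊛ pow Q n} {a ⊛ (Q ^ₖ n)} (K.*-congˡ {a} (pow≗^ Q n)))) (⟨⟩≗poch a Q n)

poch∞-lim : ∀ a {Q} → Ord 1 Q → Lim (poch a Q) (poch∞ a Q)
poch∞-lim a {Q} hQ n m m<n = trans
  (cong (λ z → poch∞ a Q m ℤ.- z) (trans (sym (⟨⟩≗poch a Q n m)) (poch-stable a Q (hQ 0 (s≤s z≤n)) m n m<n)))
  (ℤₚ.+-inverseʳ (poch∞ a Q m))

-- Long division is hard to manipulate directly; this reduces every identity between quotients to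
-- one between products.
⊘-unique : ∀ {d} f h → d 0 ≡ 1ℤ → f ⊛ d ≗ h → f ≗ h ⊘ d
⊘-unique {d} f h d0 fd = cancel-~1 {d} {f} {h ⊘ d} unit
  (K.trans {d ⊛ f} {h} {d ⊛ (h ⊘ d)} (K.trans {d ⊛ f} {f ⊛ d} (K.*-comm d f) fd)
    (K.trans {h} {(h ⊘ d) ⊛ d} (K.sym {(h ⊘ d) ⊛ d} {h} (⊘-⊛ h d d0)) (K.*-comm (h ⊘ d) d)))
  where
  unit : d ~[ 1 ] 1ₛ
  unit zero    _        = cong (ℤ._- 1ℤ) d0
  unit (suc m) (s≤s ())

q^-+ : ∀ m n → q^ m ⊛ q^ n ≗ q^ (m + n)
q^-+ zero    n = K.*-identityˡ (q^ n)
q^-+ (suc m) n zero    = refl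
-- `q^ (suc m)` has constant term 0, and dropping that term leaves `q^ m`.
q^-+ (suc m) n (suc k) = trans (ℤₚ.+-identityˡ _) (q^-+ m n k)

q^-^ : ∀ m n → (q^ m) ^ₖ n ≗ q^ (m * n)
q^-^ m zero    k rewrite ℕₚ.*-zeroʳ m = refl
q^-^ m (suc n) k rewrite ℕₚ.*-suc m n = trans (K.*-congˡ {q^ m} (q^-^ m n) k) (q^-+ m (m * n) k)

q^-ord : ∀ n → Ord n (q^ n)
q^-ord n m m<n = q^-order n m m<n

q^-cong : ∀ {m n} → m ≡ n → q^ m ≗ q^ n
q^-cong refl _ = refl

open InfiniteProducts poch∞ poch∞-lim

-- Triangular numbers and the exponents of the summands.

tri : ℕ → ℕ
tri zero    = 0
tri (suc n) = n + tri n

-- The formula tri n = n(n - 1)/2 in a form without subtraction or division, as the semiring solver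
-- requires.
tri-square : ∀ n → 2 * tri n + n ≡ n * n
tri-square zero    = refl
tri-square (suc n) =
  trans (solve 2 (λ n t → con 2 :* (n :+ t) :+ (con 1 :+ n) := con 2 :* t :+ n :+ (con 1 :+ con 2 :* n)) refl n (tri n))
  (trans (cong (_+ (1 + 2 * n)) (tri-square n)) (solve 1 (λ n → n :* n :+ (con 1 :+ con 2 :* n) := (con 1 :+ n) :* (con 1 :+ n)) refl n))
  where open +-*-Solver

tri-half : ∀ n → 3 * n * (n ∸ 1) / 2 ≡ 3 * tri n
tri-half zero    = refl
tri-half (suc n) = trans (cong (_/ 2) twice) (m*n/n≡m (3 * tri (suc n)) 2)
  where
  open +-*-Solver
  twice : 3 * suc n * n ≡ 3 * tri (suc n) * 2
  twice = trans (solve 1 (λ n → con 3 :* (con 1 :+ n) :* n := con 3 :* (n :* n) :+ con 3 :* n) refl n)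
    (trans (cong (λ s → 3 * s + 3 * n) (sym (tri-square n)))
      (solve 2 (λ n t → con 3 :* (con 2 :* t :+ n) :+ con 3 :* n := con 3 :* (n :+ t) :* con 2) refl n (tri n)))

double≡2* : ∀ n → double n ≡ 2 * n
double≡2* zero    = refl
double≡2* (suc n) = trans (cong (2 +_) (double≡2* n)) (sym (ℕₚ.*-suc 2 n))

-- On the left stand the exponents of w, of the coefficient of (-q² t; q)∞ and of that of 1/(q³ t²;
-- q³)∞; the factor `1 *` keeps the shape of `euler 1 2 i`. Doubling both sides removes the halves
-- hidden in `tri`.
exponent-I : ∀ i j → 3 * tri (i + double j) + (1 * tri i + 2 * i) + 3 * j ≡ 2 * i ^ 2 + 6 * i * j + 6 * j ^ 2
exponent-I i j rewrite double≡2* j = ℕₚ.*-cancelˡ-≡ _ _ 2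
  (trans (solve 4 (λ i j t T → con 2 :* (con 3 :* T :+ (con 1 :* t :+ con 2 :* i) :+ con 3 :* j) :=
                               con 3 :* (con 2 :* T :+ (i :+ con 2 :* j)) :+ (con 2 :* t :+ i)) refl i j (tri i) (tri (i + 2 * j)))
    (trans (cong₂ (λ x y → 3 * x + y) (tri-square (i + 2 * j)) (tri-square i))
      (solve 2 (λ i j → con 3 :* ((i :+ con 2 :* j) :* (i :+ con 2 :* j)) :+ i :* i :=
                        con 2 :* (con 2 :* i :^ 2 :+ con 6 :* i :* j :+ con 6 :* j :^ 2)) refl i j)))
  where open +-*-Solver

exponent-A : ∀ i j → 3 * tri (i + double j) + (1 * tri i + 3 * i) + 3 * j ≡ 2 * i ^ 2 + 6 * i * j + 6 * j ^ 2 + i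
exponent-A i j = trans
  (solve 4 (λ i j t T → con 3 :* T :+ (con 1 :* t :+ con 3 :* i) :+ con 3 :* j :=
                        con 3 :* T :+ (con 1 :* t :+ con 2 :* i) :+ con 3 :* j :+ i) refl i j (tri i) (tri (i + double j)))
  (cong (_+ i) (exponent-I i j))
  where open +-*-Solver

exponent-B : ∀ i j → 3 * tri (suc (i + double j)) + 1 + (1 * tri i + 3 * i) + 3 * j ≡
                     2 * i ^ 2 + 6 * i * j + 6 * j ^ 2 + 4 * i + 6 * j + 1
exponent-B i j =
  trans (cong (λ d → 3 * (i + d + tri (i + double j)) + 1 + (1 * tri i + 3 * i) + 3 * j) (double≡2* j))
  (trans (solve 4 (λ i j t T → con 3 :* (i :+ con 2 :* j :+ T) :+ con 1 :+ (con 1 :* t :+ con 3 :* i) :+ con 3 :* j :=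
                               con 3 :* T :+ (con 1 :* t :+ con 2 :* i) :+ con 3 :* j :+ con 4 :* i :+ con 6 :* j :+ con 1)
           refl i j (tri i) (tri (i + double j)))
    (cong (λ e → e + 4 * i + 6 * j + 1) (exponent-I i j)))
  where open +-*-Solver

exponent-Q : ∀ i j k l →
  3 * tri (i + (j + (k + double l))) + 3 * i + (3 * tri j + 5 * j) + (3 * tri k + 1 * k) + 3 * l ≡
  3 * (i + j + k + 2 * l) * (i + j + k + 2 * l ∸ 1) / 2 + 3 * i + 5 * j + 3 * j * (j ∸ 1) / 2 + k + 3 * k * (k ∸ 1) / 2 + 3 * l
exponent-Q i j k l
  rewrite tri-half (i + j + k + 2 * l) | tri-half j | tri-half k | double≡2* l
        | sym (ℕₚ.+-assoc j k (2 * l)) | sym (ℕₚ.+-assoc i (j + k) (2 * l)) | sym (ℕₚ.+-assoc i j k) =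
  solve 7 (λ i j k l t u v → con 3 :* t :+ con 3 :* i :+ (con 3 :* u :+ con 5 :* j) :+ (con 3 :* v :+ con 1 :* k) :+ con 3 :* l :=
                             con 3 :* t :+ con 3 :* i :+ con 5 :* j :+ con 3 :* u :+ k :+ con 3 :* v :+ con 3 :* l)
    refl i j k l (tri (i + j + k + 2 * l)) (tri j) (tri k)
  where open +-*-Solver

-- The summands as coefficients of q-products.

⟨⟩-unit : ∀ s n → 1 ≤ s → (⟨ q^ s ⨾ q^ s ⟩ n) 0 ≡ 1ℤ
⟨⟩-unit s n 1≤s = poch-unit (q^ s) (q^ s) n (q^-order s 0 1≤s)

⊘-⊛-⊘ : ∀ {d d′} x y → d 0 ≡ 1ℤ → d′ 0 ≡ 1ℤ → (q^ x ⊘ d) ⊛ (q^ y ⊘ d′) ≗ q^ (x + y) ⊘ (d ⊛ d′)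
⊘-⊛-⊘ {d} {d′} x y d0 d′0 = ⊘-unique (h ⊛ h′) (q^ (x + y)) (⊛-unit d d′ d0 d′0)
  (K.trans {h ⊛ h′ ⊛ (d ⊛ d′)} {(h ⊛ d) ⊛ (h′ ⊛ d′)} {q^ (x + y)} (interchange h h′ d d′)
    (K.trans {(h ⊛ d) ⊛ (h′ ⊛ d′)} {q^ x ⊛ q^ y} {q^ (x + y)}
      (K.*-cong {h ⊛ d} {q^ x} {h′ ⊛ d′} {q^ y} (⊘-⊛ (q^ x) d d0) (⊘-⊛ (q^ y) d′ d′0)) (q^-+ x y)))
  where
  h h′ : PS
  h = q^ x ⊘ d
  h′ = q^ y ⊘ d′
  interchange : ∀ f g h k → f ⊛ g ⊛ (h ⊛ k) ≗ (f ⊛ h) ⊛ (g ⊛ k)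
  interchange =
    KSolver.solve 4 (λ f g h k → f KSolver.:* g KSolver.:* (h KSolver.:* k) KSolver.:= (f KSolver.:* h) KSolver.:* (g KSolver.:* k)) λ _ → refl

q^-⊛-⊘ : ∀ {d} x y → d 0 ≡ 1ℤ → q^ x ⊛ (q^ y ⊘ d) ≗ q^ (x + y) ⊘ d
q^-⊛-⊘ {d} x y d0 = ⊘-unique (q^ x ⊛ (q^ y ⊘ d)) (q^ (x + y)) d0
  (K.trans {q^ x ⊛ (q^ y ⊘ d) ⊛ d} {q^ x ⊛ ((q^ y ⊘ d) ⊛ d)} {q^ (x + y)} (K.*-assoc (q^ x) (q^ y ⊘ d) d)
    (K.trans {q^ x ⊛ ((q^ y ⊘ d) ⊛ d)} {q^ x ⊛ q^ y} {q^ (x + y)} (K.*-congˡ {q^ x} (⊘-⊛ (q^ y) d d0)) (q^-+ x y)))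

-- Euler's closed forms for the coefficients of (-q^e t; q^s)∞ and of 1/(q^e t; q^s)∞.
euler inverse : ℕ → ℕ → ℕ → PS
euler s e i   = q^ (s * tri i + e * i) ⊘ ⟨ q^ s ⨾ q^ s ⟩ i
inverse s e i = q^ (e * i) ⊘ ⟨ q^ s ⨾ q^ s ⟩ i

q^-positive : ∀ {s} → 1 ≤ s → Ord 1 (q^ s)
q^-positive {s} 1≤s = ord-≤ {1} {s} {q^ s} 1≤s (q^-ord s)

⊘-poch : ∀ s x n → 1 ≤ s → (q^ x ⊘ ⟨ q^ s ⨾ q^ s ⟩ n) ⊛ poch (q^ s) (q^ s) n ≗ q^ x
⊘-poch s x n 1≤s = K.trans {h ⊛ poch (q^ s) (q^ s) n} {h ⊛ ⟨ q^ s ⨾ q^ s ⟩ n} {q^ x}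
  (K.*-congˡ {h} (K.sym {⟨ q^ s ⨾ q^ s ⟩ n} {poch (q^ s) (q^ s) n} (⟨⟩≗poch (q^ s) (q^ s) n)))
  (⊘-⊛ (q^ x) (⟨ q^ s ⨾ q^ s ⟩ n) (⟨⟩-unit s n 1≤s))
  where
  h : PS
  h = q^ x ⊘ ⟨ q^ s ⨾ q^ s ⟩ n

euler-isEuler : ∀ s e → 1 ≤ s → IsEuler (q^ s) (q^ e) (euler s e)
euler-isEuler s e 1≤s = euler-quotient {q^ s} {q^ e} {E} {euler s e} (q^-positive 1≤s)
  (q^-cong (cong₂ _+_ (ℕₚ.*-zeroʳ s) (ℕₚ.*-zeroʳ e))) E-suc
  (λ n → ⊘-poch s (s * tri n + e * n) n 1≤s)
  where
  open +-*-Solver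
  E : ℕ → PS
  E n = q^ (s * tri n + e * n)
  E-suc : ∀ n → E (suc n) ≗ q^ e ⊛ ((q^ s) ^ₖ n ⊛ E n)
  E-suc n = K.trans {E (suc n)} {q^ (e + (s * n + (s * tri n + e * n)))} {q^ e ⊛ ((q^ s) ^ₖ n ⊛ E n)}
    (q^-cong (solve 4 (λ s e n t → s :* (n :+ t) :+ e :* (con 1 :+ n) := e :+ (s :* n :+ (s :* t :+ e :* n))) refl s e n (tri n)))
    (K.sym {q^ e ⊛ ((q^ s) ^ₖ n ⊛ E n)} {q^ (e + (s * n + (s * tri n + e * n)))}
      (K.trans {q^ e ⊛ ((q^ s) ^ₖ n ⊛ E n)} {q^ e ⊛ q^ (s * n + (s * tri n + e * n))}
        (K.*-congˡ {q^ e} (K.trans {(q^ s) ^ₖ n ⊛ E n} {q^ (s * n) ⊛ E n} {q^ (s * n + (s * tri n + e * n))}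
          (K.*-congʳ {E n} {(q^ s) ^ₖ n} {q^ (s * n)} (q^-^ s n)) (q^-+ (s * n) (s * tri n + e * n))))
        (q^-+ e (s * n + (s * tri n + e * n)))))

inverse-isInverse : ∀ s e → 1 ≤ s → IsInverse (q^ s) (q^ e) (inverse s e)
inverse-isInverse s e 1≤s = inverse-quotient {q^ s} {q^ e} {λ n → q^ (e * n)} {inverse s e} (q^-positive 1≤s)
  (q^-cong (ℕₚ.*-zeroʳ e)) (λ n → K.trans {q^ (e * suc n)} {q^ (e + e * n)} {q^ e ⊛ q^ (e * n)} (q^-cong (ℕₚ.*-suc e n))
    (K.sym {q^ e ⊛ q^ (e * n)} {q^ (e + e * n)} (q^-+ e (e * n))))
  (λ n → ⊘-poch s (e * n) n 1≤s)

q^-⊛ : ∀ m n {o} → m + n ≡ o → q^ m ⊛ q^ n ≗ q^ o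
q^-⊛ m n refl = q^-+ m n

weight : ℕ → PS
weight n = q^ (3 * tri n)

weight-suc : ∀ n → weight (suc n) ≗ (q^ 3) ^ₖ n ⊛ weight n
weight-suc n =
  K.trans {weight (suc n)} {q^ (3 * n + 3 * tri n)} {(q^ 3) ^ₖ n ⊛ weight n} (q^-cong (ℕₚ.*-distribˡ-+ 3 n (tri n)))
  (K.sym {(q^ 3) ^ₖ n ⊛ weight n} {q^ (3 * n + 3 * tri n)}
    (K.trans {(q^ 3) ^ₖ n ⊛ weight n} {q^ (3 * n) ⊛ weight n} (K.*-congʳ {weight n} {(q^ 3) ^ₖ n} {q^ (3 * n)} (q^-^ 3 n)) (q^-+ (3 * n) (3 * tri n))))

q^3-cube : q^ 3 ≗ q^ 1 ⊛ (q^ 1 ⊛ q^ 1)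
q^3-cube = K.sym {q^ 1 ⊛ (q^ 1 ⊛ q^ 1)} {q^ 3}
  (K.trans {q^ 1 ⊛ (q^ 1 ⊛ q^ 1)} {q^ 1 ⊛ q^ 2} (K.*-congˡ {q^ 1} (q^-+ 1 1)) (q^-+ 1 2))

q-shift² : ∀ e → q^ 1 ⊛ (q^ 1 ⊛ q^ e) ≗ q^ (2 + e)
q-shift² e = K.trans {q^ 1 ⊛ (q^ 1 ⊛ q^ e)} {q^ 1 ⊛ q^ (1 + e)} (K.*-congˡ {q^ 1} (q^-+ 1 e)) (q^-+ 1 (1 + e))

-- a = q^x and b = q^y, with p = q^3 and a b = p².
module Specialised (x y : ℕ) (1≤x : 1 ≤ x) (1≤y : 1 ≤ y) (x+y≡6 : x + y ≡ 6) where

  product : PS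
  product = poch∞ (⊝ q^ 3) (q^ 3) ⊛ (poch∞ (⊝ q^ x) (q^ 6) ⊛ poch∞ (⊝ q^ y) (q^ 6))

  1≤3 : 1 ≤ 3
  1≤3 = s≤s z≤n

  1≤6 : 1 ≤ 6
  1≤6 = s≤s z≤n

  q^6-square : q^ 6 ≗ q^ 3 ⊛ q^ 3
  q^6-square = K.sym {q^ 3 ⊛ q^ 3} {q^ 6} (q^-+ 3 3)

  2≤order : Ord 2 (q^ 3)
  2≤order = ord-≤ {2} {3} {q^ 3} (s≤s (s≤s z≤n)) (q^-ord 3)

  xy : q^ x ⊛ q^ y ≗ q^ 3 ⊛ q^ 3
  xy = K.trans {q^ x ⊛ q^ y} {q^ 6} {q^ 3 ⊛ q^ 3} (q^-⊛ x y x+y≡6) q^6-square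

  r-inv : IsInverse (q^ 3) (q^ 3) (inverse 3 3)
  r-inv = inverse-isInverse 3 3 1≤3

  v-inv : IsInverse (q^ 3 ⊛ q^ 3) (q^ 3) (inverse 6 3)
  v-inv = IsInverse-base {q^ 6} q^6-square (inverse-isInverse 6 3 1≤6)

  euler² : ∀ e → IsEuler (q^ 3 ⊛ q^ 3) (q^ e) (euler 6 e)
  euler² e = IsEuler-base {q^ 6} q^6-square (euler-isEuler 6 e 1≤6)

  lim-P : Lim (poch (⊝ q^ 3) (q^ 3)) (poch∞ (⊝ q^ 3) (q^ 3))
  lim-P = poch∞-lim (⊝ q^ 3) (q^-positive 1≤3)

  lim² : ∀ e → Lim (poch (⊝ q^ e) (q^ 3 ⊛ q^ 3)) (poch∞ (⊝ q^ e) (q^ 6))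
  lim² e n =
    ~-trans {n} {poch∞ (⊝ q^ e) (q^ 6)} {poch (⊝ q^ e) (q^ 6) n} (poch∞-lim (⊝ q^ e) (q^-positive 1≤6) n)
    (~-reflexive {n} {poch (⊝ q^ e) (q^ 6) n} (poch-cong {⊝ q^ e} {⊝ q^ e} (λ _ → refl) q^6-square n))

  quadruple : ∑∞ (λ i → ∑∞ (λ j → ∑∞ (λ k → ∑∞ (λ l →
                weight (i + (j + (k + double l))) ⊛ inverse 3 3 i ⊛ euler 3 x j ⊛ euler 3 y k ⊛ inverse 6 3 l)))) ≗ product
  quadruple =
    quadruple-sum {q^ 3} {q^ x} {q^ y} 2≤order (q^-positive 1≤x) (q^-positive 1≤y) xy {weight} (λ _ → refl) weight-suc
    {inverse 3 3} {euler 3 x} {euler 3 y} {inverse 6 3} {euler 6 x} {euler 6 y}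
    r-inv v-inv (euler-isEuler 3 x 1≤3) (euler-isEuler 3 y 1≤3) (euler² x) (euler² y)
    {poch∞ (⊝ q^ 3) (q^ 3)} {poch∞ (⊝ q^ x) (q^ 6)} {poch∞ (⊝ q^ y) (q^ 6)}
      lim-P (lim² x) (lim² y)

  module _ (c : ℕ) (1≤c : 1 ≤ c) where

    double-1 : c ≡ x → 1 + c ≡ 3 → 2 + c ≡ y →
               ∑∞ (λ i → ∑∞ (λ j → weight (i + double j) ⊛ euler 1 c i ⊛ inverse 3 3 j)) ≗ product
    double-1 h₁ h₂ h₃ =
      double-sum-1 {q^ 3} {q^ x} {q^ y} 2≤order (q^-positive 1≤x) (q^-positive 1≤y) xy {weight} (λ _ → refl) weight-suc
      {inverse 3 3} {euler 3 x} {euler 3 y} {inverse 6 3} {euler 6 x} {euler 6 y}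
      r-inv v-inv (euler-isEuler 3 x 1≤3) (euler-isEuler 3 y 1≤3) (euler² x) (euler² y)
      {q^ 1} {q^ c} {euler 1 c} (q^-positive (s≤s z≤n)) (q^-positive 1≤c) q^3-cube (euler-isEuler 1 c (s≤s z≤n))
      {poch∞ (⊝ q^ 3) (q^ 3)} {poch∞ (⊝ q^ x) (q^ 6)} {poch∞ (⊝ q^ y) (q^ 6)}
      lim-P (lim² x) (lim² y) (q^-cong h₁) (q^-⊛ 1 c h₂)
      (K.trans {q^ 1 ⊛ (q^ 1 ⊛ q^ c)} {q^ (2 + c)} {q^ y} (q-shift² c) (q^-cong h₃))

    double-2 : c ≡ 3 → 1 ≡ y → 2 + c ≡ x →
               ∑∞ (λ i → ∑∞ (λ j → weight (i + double j) ⊛ euler 1 c i ⊛ inverse 3 3 j)) ⊕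
               ∑∞ (λ i → ∑∞ (λ j → weight (suc (i + double j)) ⊛ q^ y ⊛ euler 1 c i ⊛ inverse 3 3 j)) ≗ product
    double-2 h₁ h₂ h₃ =
      double-sum-2 {q^ 3} {q^ x} {q^ y} 2≤order (q^-positive 1≤x) (q^-positive 1≤y) xy {weight} (λ _ → refl) weight-suc
      {inverse 3 3} {euler 3 x} {euler 3 y} {inverse 6 3} {euler 6 x} {euler 6 y}
      r-inv v-inv (euler-isEuler 3 x 1≤3) (euler-isEuler 3 y 1≤3) (euler² x) (euler² y)
      {q^ 1} {q^ c} {euler 1 c} (q^-positive (s≤s z≤n)) (q^-positive 1≤c) q^3-cube (euler-isEuler 1 c (s≤s z≤n))
      {poch∞ (⊝ q^ 3) (q^ 3)} {poch∞ (⊝ q^ x) (q^ 6)} {poch∞ (⊝ q^ y) (q^ 6)}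
      lim-P (lim² x) (lim² y) (q^-cong h₁) (q^-cong h₂)
      (K.trans {q^ 1 ⊛ (q^ 1 ⊛ q^ c)} {q^ (2 + c)} {q^ x} (q-shift² c) (q^-cong h₃))

module First = Specialised 2 4 (s≤s z≤n) (s≤s z≤n) refl
-- The order of 5 and 1 matters: the extra factor in the second pair of double sums is 1 + b t, so b
-- must be q.
module Second = Specialised 5 1 (s≤s z≤n) (s≤s z≤n) refl

-- From the stated sums to iterated sums, and the final products.

⊘-cong : ∀ {m n} d → m ≡ n → q^ m ⊘ d ≗ q^ n ⊘ d
⊘-cong d refl _ = refl

⟨3⟩ ⟨1⟩ : ℕ → PS
⟨3⟩ = ⟨ q^ 3 ⨾ q^ 3 ⟩_
⟨1⟩ = ⟨ q^ 1 ⨾ q^ 1 ⟩_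

⟨1⟩-unit : ∀ n → ⟨1⟩ n 0 ≡ 1ℤ
⟨1⟩-unit n = ⟨⟩-unit 1 n (s≤s z≤n)

⟨3⟩-unit : ∀ n → ⟨3⟩ n 0 ≡ 1ℤ
⟨3⟩-unit n = ⟨⟩-unit 3 n (s≤s z≤n)

double-term : ∀ e c i j → q^ e ⊛ euler 1 c i ⊛ inverse 3 3 j ≗
                          q^ (e + (1 * tri i + c * i) + 3 * j) ⊘ (⟨1⟩ i ⊛ ⟨3⟩ j)
double-term e c i j =
  K.trans {q^ e ⊛ euler 1 c i ⊛ inverse 3 3 j} {(q^ (e + (1 * tri i + c * i)) ⊘ ⟨1⟩ i) ⊛ inverse 3 3 j}
  (K.*-congʳ {inverse 3 3 j} {q^ e ⊛ euler 1 c i} {q^ (e + (1 * tri i + c * i)) ⊘ ⟨1⟩ i} (q^-⊛-⊘ e (1 * tri i + c * i) (⟨1⟩-unit i)))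
  (⊘-⊛-⊘ (e + (1 * tri i + c * i)) (3 * j) (⟨1⟩-unit i) (⟨3⟩-unit j))

quadruple-term : ∀ e i j k l → q^ e ⊛ inverse 3 3 i ⊛ euler 3 5 j ⊛ euler 3 1 k ⊛ inverse 6 3 l ≗
  q^ (e + 3 * i + (3 * tri j + 5 * j) + (3 * tri k + 1 * k) + 3 * l) ⊘ (⟨3⟩ i ⊛ ⟨3⟩ j ⊛ ⟨3⟩ k ⊛ ⟨ q^ 6 ⨾ q^ 6 ⟩ l)
quadruple-term e i j k l =
  step (inverse 6 3 l) (q^ e ⊛ r ⊛ α ⊛ β) e₃ d₃
    (step β (q^ e ⊛ r ⊛ α) e₂ d₂
      (step α (q^ e ⊛ r) e₁ (⟨3⟩ i) (q^-⊛-⊘ e (3 * i) (⟨3⟩-unit i)) (⊘-⊛-⊘ e₁ _ (⟨3⟩-unit i) (⟨3⟩-unit j)))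
      (⊘-⊛-⊘ e₂ _ d₂-unit (⟨3⟩-unit k)))
    (⊘-⊛-⊘ e₃ _ (⊛-unit d₂ (⟨3⟩ k) d₂-unit (⟨3⟩-unit k)) (⟨⟩-unit 6 l (s≤s z≤n)))
  where
  r α β d₂ d₃ : PS
  r = inverse 3 3 i
  α = euler 3 5 j
  β = euler 3 1 k
  d₂ = ⟨3⟩ i ⊛ ⟨3⟩ j
  d₃ = d₂ ⊛ ⟨3⟩ k
  e₁ e₂ e₃ : ℕ
  e₁ = e + 3 * i
  e₂ = e₁ + (3 * tri j + 5 * j)
  e₃ = e₂ + (3 * tri k + 1 * k)
  d₂-unit : d₂ 0 ≡ 1ℤ
  d₂-unit = ⊛-unit (⟨3⟩ i) (⟨3⟩ j) (⟨3⟩-unit i) (⟨3⟩-unit j)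
  step : ∀ h f e d {g} → f ≗ q^ e ⊘ d → (q^ e ⊘ d) ⊛ h ≗ g → f ⊛ h ≗ g
  step h f e d {g} f≗ h≗ = K.trans {f ⊛ h} {(q^ e ⊘ d) ⊛ h} {g} (K.*-congʳ {h} {f} {q^ e ⊘ d} f≗) h≗

-- At qⁿ the summability witness is the square of indices up to n, and the nested `∑∞` cut each
-- index at n too, so the finite sums agree term by term.
∑-range₂ : ∀ (F : ℕ × ℕ → PS) s (G : ℕ → ℕ → PS) → (∀ n → proj₁ (s n) ≡ cartesianProduct (range n) (range n)) →
  (∀ i j → F (i , j) ≗ G i j) → ∑ F s ≗ ∑∞ (λ i → ∑∞ (G i))
∑-range₂ F s G box F≗G n =
  trans (cong (λ L → sumℤ (map (λ v → F v n) L)) (box n)) (trans (sumℤ-range₂ n (λ v → F v n))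
  (ℤ[].∑<-cong (suc n) {λ i → ∑∞ (λ j → F (i , j)) n} {λ i → ∑∞ (G i) n} λ i →
    ℤ[].∑<-cong (suc n) {λ j → F (i , j) n} {λ j → G i j n} λ j → F≗G i j n))

∑-range₄ : ∀ (F : ℕ × ℕ × ℕ × ℕ → PS) s (G : ℕ → ℕ → ℕ → ℕ → PS) →
  (∀ n → proj₁ (s n) ≡ cartesianProduct (range n) (cartesianProduct (range n) (cartesianProduct (range n) (range n)))) →
  (∀ i j k l → F (i , j , k , l) ≗ G i j k l) → ∑ F s ≗ ∑∞ (λ i → ∑∞ (λ j → ∑∞ (λ k → ∑∞ (G i j k))))
∑-range₄ F s G box F≗G n =
  trans (cong (λ L → sumℤ (map (λ v → F v n) L)) (box n)) (trans (sumℤ-range₄ n (λ v → F v n))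
  (ℤ[].∑<-cong (suc n) {λ i → ∑∞ (λ j → ∑∞ (λ k → ∑∞ (λ l → F (i , j , k , l)))) n} {λ i → ∑∞ (λ j → ∑∞ (λ k → ∑∞ (G i j k))) n} λ i →
    ℤ[].∑<-cong (suc n) {λ j → ∑∞ (λ k → ∑∞ (λ l → F (i , j , k , l))) n} {λ j → ∑∞ (λ k → ∑∞ (G i j k)) n} λ j →
      ℤ[].∑<-cong (suc n) {λ k → ∑∞ (λ l → F (i , j , k , l)) n} {λ k → ∑∞ (G i j k) n} λ k →
        ℤ[].∑<-cong (suc n) {λ l → F (i , j , k , l) n} {λ l → G i j k l n} λ l → F≗G i j k l n))

reciprocal : First.product ⊛ ⟨ q^ 2 ∷ q^ 3 ∷ q^ 9 ∷ q^ 10 ∷ [] ⨾ q^ 12 ⟩∞ ≗ 1ₛ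
reciprocal = capparelli-reciprocal {q^ 2} {q^ 4} {q^ 3} {q^ 6} {q^ 12} {q^ 9} {q^ 10}
  (q^-positive (s≤s z≤n)) (q^-positive (s≤s z≤n)) (q^-positive (s≤s z≤n))
  (q^-+ 2 2) (q^-+ 2 4) (q^-+ 3 3) (q^-+ 6 6) (q^-+ 3 6) (q^-+ 4 6)

divisor-unit : ⟨ q^ 2 ∷ q^ 3 ∷ q^ 9 ∷ q^ 10 ∷ [] ⨾ q^ 12 ⟩∞ 0 ≡ 1ℤ
divisor-unit = refl

-- Brings (-q³; q³)∞ to the base q⁶ of the claimed product, where it supplies the factors for -q³
-- and -q⁶.
P∞-dissect : poch∞ (⊝ q^ 3) (q^ 3) ≗ poch∞ (⊝ q^ 3) (q^ 6) ⊛ poch∞ (⊝ q^ 6) (q^ 6)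
P∞-dissect = poch∞-dissect {⊝ q^ 3} {⊝ q^ 6} {q^ 3} {q^ 6} (q^-positive (s≤s z≤n))
  (K.trans {(⊝ q^ 3) ⊛ q^ 3} {⊝ (q^ 3 ⊛ q^ 3)} {⊝ q^ 6}
    (K.sym {⊝ (q^ 3 ⊛ q^ 3)} {(⊝ q^ 3) ⊛ q^ 3} (RingProperties.-‿distribˡ-* K.ring (q^ 3) (q^ 3)))
    (K.-‿cong {q^ 3 ⊛ q^ 3} {q^ 6} (q^-+ 3 3)))
  (q^-+ 3 3)

product₂ : Second.product ≗ ⟨ ⊝ q^ 1 ∷ ⊝ q^ 3 ∷ ⊝ q^ 5 ∷ ⊝ q^ 6 ∷ [] ⨾ q^ 6 ⟩∞
product₂ = K.trans {Second.product} {P₃ ⊛ P₆ ⊛ (P₅ ⊛ P₁)} {⟨ ⊝ q^ 1 ∷ ⊝ q^ 3 ∷ ⊝ q^ 5 ∷ ⊝ q^ 6 ∷ [] ⨾ q^ 6 ⟩∞}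
  (K.*-congʳ {P₅ ⊛ P₁} {poch∞ (⊝ q^ 3) (q^ 3)} {P₃ ⊛ P₆} P∞-dissect)
  (solve 4 (λ a b c d → b :* d :* (c :* a) := a :* (b :* (c :* (d :* con 1ℤ)))) (λ _ → refl) P₁ P₃ P₅ P₆)
  where
  open KSolver
  P₁ P₃ P₅ P₆ : PS
  P₁ = poch∞ (⊝ q^ 1) (q^ 6)
  P₃ = poch∞ (⊝ q^ 3) (q^ 6)
  P₅ = poch∞ (⊝ q^ 5) (q^ 6)
  P₆ = poch∞ (⊝ q^ 6) (q^ 6)

sum-I sum-A sum-B sum-Q : PS
sum-I = ∑ (λ ((i , j) : ℕ × ℕ) →
  q^ (2 * i ^ 2 + 6 * i * j + 6 * j ^ 2) ⊘ (⟨ q^ 1 ⨾ q^ 1 ⟩ i ⊛ ⟨ q^ 3 ⨾ q^ 3 ⟩ j)) summable-I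
sum-A = ∑ (λ ((i , j) : ℕ × ℕ) →
  q^ (2 * i ^ 2 + 6 * i * j + 6 * j ^ 2 + i) ⊘ (⟨ q^ 1 ⨾ q^ 1 ⟩ i ⊛ ⟨ q^ 3 ⨾ q^ 3 ⟩ j)) summable-A
sum-B = ∑ (λ ((i , j) : ℕ × ℕ) →
  q^ (2 * i ^ 2 + 6 * i * j + 6 * j ^ 2 + 4 * i + 6 * j + 1) ⊘ (⟨ q^ 1 ⨾ q^ 1 ⟩ i ⊛ ⟨ q^ 3 ⨾ q^ 3 ⟩ j)) summable-B
sum-Q = ∑ (λ ((i , j , k , l) : ℕ × ℕ × ℕ × ℕ) →
  q^ (3 * (i + j + k + 2 * l) * (i + j + k + 2 * l ∸ 1) / 2
       + 3 * i + 5 * j + 3 * j * (j ∸ 1) / 2 + k + 3 * k * (k ∸ 1) / 2 + 3 * l)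
    ⊘ (⟨ q^ 3 ⨾ q^ 3 ⟩ i ⊛ ⟨ q^ 3 ⨾ q^ 3 ⟩ j ⊛ ⟨ q^ 3 ⨾ q^ 3 ⟩ k ⊛ ⟨ q^ 6 ⨾ q^ 6 ⟩ l)) summable-Q

I≗product : sum-I ≗ First.product
I≗product n =
  trans (∑-range₂ _ summable-I (λ i j → weight (i + double j) ⊛ euler 1 2 i ⊛ inverse 3 3 j) (λ _ → refl)
    (λ i j m → trans (⊘-cong (⟨1⟩ i ⊛ ⟨3⟩ j) (sym (exponent-I i j)) m) (sym (double-term (3 * tri (i + double j)) 2 i j m))) n)
  (First.double-1 2 (s≤s z≤n) refl refl refl n)

A≗ : sum-A ≗ ∑∞ (λ i → ∑∞ (λ j → weight (i + double j) ⊛ euler 1 3 i ⊛ inverse 3 3 j))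
A≗ = ∑-range₂ _ summable-A (λ i j → weight (i + double j) ⊛ euler 1 3 i ⊛ inverse 3 3 j) (λ _ → refl)
  (λ i j m → trans (⊘-cong (⟨1⟩ i ⊛ ⟨3⟩ j) (sym (exponent-A i j)) m) (sym (double-term (3 * tri (i + double j)) 3 i j m)))

B≗ : sum-B ≗ ∑∞ (λ i → ∑∞ (λ j → weight (suc (i + double j)) ⊛ q^ 1 ⊛ euler 1 3 i ⊛ inverse 3 3 j))
B≗ =
  ∑-range₂ _ summable-B (λ i j → weight (suc (i + double j)) ⊛ q^ 1 ⊛ euler 1 3 i ⊛ inverse 3 3 j) (λ _ → refl) λ i j →
  let e = 3 * tri (suc (i + double j)) in
  K.trans {q^ (2 * i ^ 2 + 6 * i * j + 6 * j ^ 2 + 4 * i + 6 * j + 1) ⊘ (⟨1⟩ i ⊛ ⟨3⟩ j)}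
          {q^ (e + 1) ⊛ euler 1 3 i ⊛ inverse 3 3 j} {q^ e ⊛ q^ 1 ⊛ euler 1 3 i ⊛ inverse 3 3 j}
    (λ m → trans (⊘-cong (⟨1⟩ i ⊛ ⟨3⟩ j) (sym (exponent-B i j)) m) (sym (double-term (e + 1) 3 i j m)))
    -- The splitting of `1 + b t` delivers the weight and b = q as separate factors, so q^(e + 1)
    -- has to be taken apart.
    (K.*-congʳ {inverse 3 3 j} {q^ (e + 1) ⊛ euler 1 3 i} {q^ e ⊛ q^ 1 ⊛ euler 1 3 i}
      (K.*-congʳ {euler 1 3 i} {q^ (e + 1)} {q^ e ⊛ q^ 1} (K.sym {q^ e ⊛ q^ 1} {q^ (e + 1)} (q^-+ e 1))))

A⊕B≗product : sum-A ⊕ sum-B ≗ Second.product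
A⊕B≗product n = trans (cong₂ ℤ._+_ (A≗ n) (B≗ n)) (Second.double-2 3 (s≤s z≤n) refl refl refl n)

Q≗product : sum-Q ≗ Second.product
Q≗product n = trans (∑-range₄ _ summable-Q
    (λ i j k l → weight (i + (j + (k + double l))) ⊛ inverse 3 3 i ⊛ euler 3 5 j ⊛ euler 3 1 k ⊛ inverse 6 3 l) (λ _ → refl)
    (λ i j k l m → trans (⊘-cong (⟨3⟩ i ⊛ ⟨3⟩ j ⊛ ⟨3⟩ k ⊛ ⟨ q^ 6 ⨾ q^ 6 ⟩ l) (sym (exponent-Q i j k l)) m)
      (sym (quadruple-term (3 * tri (i + (j + (k + double l)))) i j k l m))) n)
  (Second.quadruple n)

theorem7p0p1 :
  let A = ∑ (λ ((i , j) : ℕ × ℕ) →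
              q^ (2 * i ^ 2 + 6 * i * j + 6 * j ^ 2 + i)
                ⊘ (⟨ q^ 1 ⨾ q^ 1 ⟩ i ⊛ ⟨ q^ 3 ⨾ q^ 3 ⟩ j)) summable-A
      B = ∑ (λ ((i , j) : ℕ × ℕ) →
              q^ (2 * i ^ 2 + 6 * i * j + 6 * j ^ 2 + 4 * i + 6 * j + 1)
                ⊘ (⟨ q^ 1 ⨾ q^ 1 ⟩ i ⊛ ⟨ q^ 3 ⨾ q^ 3 ⟩ j)) summable-B
  in
  (∑ (λ ((i , j) : ℕ × ℕ) →
       q^ (2 * i ^ 2 + 6 * i * j + 6 * j ^ 2)
         ⊘ (⟨ q^ 1 ⨾ q^ 1 ⟩ i ⊛ ⟨ q^ 3 ⨾ q^ 3 ⟩ j)) summable-I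
    ≗ 1ₛ ⊘ ⟨ q^ 2 ∷ q^ 3 ∷ q^ 9 ∷ q^ 10 ∷ [] ⨾ q^ 12 ⟩∞)
  × (∑ (λ ((i , j , k , l) : ℕ × ℕ × ℕ × ℕ) →
         q^ (3 * (i + j + k + 2 * l) * (i + j + k + 2 * l ∸ 1) / 2
              + 3 * i + 5 * j + 3 * j * (j ∸ 1) / 2 + k + 3 * k * (k ∸ 1) / 2 + 3 * l)
           ⊘ (⟨ q^ 3 ⨾ q^ 3 ⟩ i ⊛ ⟨ q^ 3 ⨾ q^ 3 ⟩ j ⊛ ⟨ q^ 3 ⨾ q^ 3 ⟩ k ⊛ ⟨ q^ 6 ⨾ q^ 6 ⟩ l))
       summable-Q
      ≗ A ⊕ B)
  × (A ⊕ B ≗ ⟨ ⊝ q^ 1 ∷ ⊝ q^ 3 ∷ ⊝ q^ 5 ∷ ⊝ q^ 6 ∷ [] ⨾ q^ 6 ⟩∞)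
theorem7p0p1 =
    (λ n → trans (I≗product n) (⊘-unique First.product 1ₛ divisor-unit reciprocal n))
  , (λ n → trans (Q≗product n) (sym (A⊕B≗product n)))
  , (λ n → trans (A⊕B≗product n) (product₂ n))
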